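{- For every positive integer $n>4$ there is a prime number $p$ with $8n<p<9n$. -}

module Defs where

{-# OPTIONS --safe #-}
module Submission where

-- Chebyshev's method. Put Λ for the von Mangoldt function, so that log m! = Σ_d Λ(d) ⌊m/d⌋, and x = 72 n.
-- A combination Σ_j c_j log ⌊x/j⌋! equals Σ_d Λ(d) W(⌊x/d⌋) with W(z) = Σ_j c_j ⌊z/j⌋. The c_j are chosen
-- such that c_8 = 1, Σ_j c_j / j = 0, W(z) = 0 for z < 8, W(8) = 1, and the positive values of W at z ≥ 9 are
-- small and occur only at large z. As ⌊x/d⌋ = 8 means 8 n < d ≤ 9 n, this gives
--   Σ_{8n < d ≤ 9n} Λ(d) ≥ -x Σ_j (c_j / j) log j - O(log x) - Σ_i u_i ψ(x / t_i),
-- where W(z) ≤ Σ_{i : z ≥ t_i} u_i for z ≥ 9 and ψ(y) ≤ y log 4. The right-hand side is at least 0.08 n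
-- asymptotically, while proper prime powers contribute only O(√n log n) to the left. Everything is
-- stated multiplicatively in ℕ, with c_j = j b_j / 45360 for integers b_j, so that Σ_j b_j = 0. Small n are
-- covered by a chain of primes.

open import Defs
open import Data.Nat using (ℕ; _*_; _<_; _>_)
open import Data.Nat.Primality using (Prime)
open import Data.Product using (∃-syntax; _×_)

open import Data.Bool using (Bool; true; false; _∧_; not; T; if_then_else_)
open import Data.Bool.Properties using (T-∧)
open import Data.List using (List; []; _∷_)
open import Data.List.Relation.Unary.All as All using (All; []; _∷_)
open import Data.Nat using (NonZero; NonTrivial; zero; suc; _+_; _^_; _∸_; _!; _≤_; z≤n; s≤s; z<s; _≟_; _≤?_; _<?_; _≤ᵇ_; _<ᵇ_; >-nonZero; ≢-nonZero; n>1⇒nonTrivial; nonTrivial⇒n>1)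
open import Data.Nat.Divisibility
open import Data.Nat.DivMod
open import Data.Nat.Induction using (<-rec)
open import Data.Nat.ListAction using (product)
open import Data.Nat.Primality hiding (Prime)
open import Data.Nat.Primality.Factorisation using (factorise)
open import Data.Nat.Properties
open import Data.Nat.Tactic.RingSolver using (solve-∀)
open import Data.Product using (_,_; proj₁; proj₂)
open import Data.Sum using (_⊎_; inj₁; inj₂)
open import Data.Unit using (tt)
open import Function using (Equivalence)
open import Relation.Binary.Definitions using (tri<; tri≈; tri>)
open import Relation.Binary.PropositionalEquality
open import Relation.Nullary using (¬_; Dec; yes; no; does; contradiction)
open import Relation.Nullary.Decidable using (_×-dec_; toWitness)

-- Division extended by x ÷ 0 = 0, so that it can be used under a product over all of ℕ.
infixl 7 _÷_
_÷_ : ℕ → ℕ → ℕ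
m ÷ zero  = 0
m ÷ suc d = m / suc d

÷-lower : ∀ m d → (m ÷ d) * d ≤ m
÷-lower m zero    = z≤n
÷-lower m (suc d) = m/n*n≤m m (suc d)

÷-upper : ∀ m d → m < suc (m ÷ suc d) * suc d
÷-upper m d = begin-strict
  m                                      ≡⟨ m≡m%n+[m/n]*n m (suc d) ⟩
  m % suc d + (m / suc d) * suc d        <⟨ +-monoˡ-< _ (m%n<n m (suc d)) ⟩
  suc d + (m / suc d) * suc d            ∎
  where open ≤-Reasoning

÷-greatest : ∀ {k m} d → k * suc d ≤ m → k ≤ m ÷ suc d
÷-greatest {k} {m} d le = subst (_≤ m / suc d) (m*n/n≡m k (suc d)) (/-monoˡ-≤ (suc d) le)

÷-unique : ∀ {q m} d → q * suc d ≤ m → m < suc q * suc d → m ÷ suc d ≡ q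
÷-unique d lo hi = ≤-antisym (≤-pred (m<n*o⇒m/o<n hi)) (÷-greatest d lo)

0÷ : ∀ d → 0 ÷ d ≡ 0
0÷ zero    = refl
0÷ (suc d) = 0/n≡0 (suc d)

<⇒÷≡0 : ∀ {m d} → m < d → m ÷ d ≡ 0
<⇒÷≡0 {d = suc d} m<d = m<n⇒m/n≡0 m<d

-- Thanks to this, the exponent of `vm d` in ⌊x/j⌋! depends on d only through ⌊x/d⌋.
÷-comm : ∀ x j d → (x ÷ j) ÷ d ≡ (x ÷ d) ÷ j
÷-comm x zero    d       = 0÷ d
÷-comm x (suc j) zero    = sym (0÷ (suc j))
÷-comm x (suc j) (suc d) = begin
  x / suc j / suc d     ≡⟨ m/n/o≡m/[n*o] x (suc j) (suc d) ⟩
  x / (suc j * suc d)   ≡⟨ /-congʳ {m = x} (*-comm (suc j) (suc d)) ⟩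
  x / (suc d * suc j)   ≡⟨ m/n/o≡m/[n*o] x (suc d) (suc j) ⟨
  x / suc d / suc j     ∎
  where open ≡-Reasoning

÷-superadditive : ∀ a b d → a ÷ d + b ÷ d ≤ (a + b) ÷ d
÷-superadditive a b zero    = z≤n
÷-superadditive a b (suc d) = ÷-greatest d (begin
  (a ÷ suc d + b ÷ suc d) * suc d             ≡⟨ *-distribʳ-+ (suc d) (a ÷ suc d) _ ⟩
  (a ÷ suc d) * suc d + (b ÷ suc d) * suc d   ≤⟨ +-mono-≤ (÷-lower a (suc d)) (÷-lower b (suc d)) ⟩
  a + b                                       ∎)
  where open ≤-Reasoning

-- Indicators

𝟙 : ∀ {ℓ} {A : Set ℓ} → Dec A → ℕ
𝟙 A? = if does A? then 1 else 0

𝟙-yes : ∀ {ℓ} {A : Set ℓ} (A? : Dec A) → A → 𝟙 A? ≡ 1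
𝟙-yes (yes _) a = refl
𝟙-yes (no ¬a) a = contradiction a ¬a

𝟙-no : ∀ {ℓ} {A : Set ℓ} (A? : Dec A) → ¬ A → 𝟙 A? ≡ 0
𝟙-no (yes a) ¬a = contradiction a ¬a
𝟙-no (no _)  ¬a = refl

𝟙≤1 : ∀ {ℓ} {A : Set ℓ} (A? : Dec A) → 𝟙 A? ≤ 1
𝟙≤1 (yes _) = ≤-refl
𝟙≤1 (no _)  = z≤n

-- The quotient counts the positive multiples of d up to m, and m + 1 is a new one exactly when d
-- divides it. This drives the induction in `!-as-∏`.
÷-suc : ∀ m d → suc m ÷ suc d ≡ m ÷ suc d + 𝟙 (suc d ∣? suc m)
÷-suc m d with m≤n⇒m<n∨m≡n (÷-upper m d)
... | inj₂ eq = begin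
  suc m ÷ suc d                          ≡⟨ ÷-unique {suc (m ÷ suc d)} d (≤-reflexive (sym eq))
                                              (subst (_< suc (suc (m ÷ suc d)) * suc d) (sym eq) (m<n+m (suc (m ÷ suc d) * suc d) z<s)) ⟩
  suc (m ÷ suc d)                        ≡⟨ +-comm 1 _ ⟩
  m ÷ suc d + 1                          ≡⟨ cong (m ÷ suc d +_) (𝟙-yes (suc d ∣? suc m) (divides (suc (m ÷ suc d)) eq)) ⟨
  m ÷ suc d + 𝟙 (suc d ∣? suc m)         ∎
  where open ≡-Reasoning
... | inj₁ lt = begin
  suc m ÷ suc d                          ≡⟨ ÷-unique d (m≤n⇒m≤1+n (÷-lower m (suc d))) lt ⟩
  m ÷ suc d                              ≡⟨ +-identityʳ _ ⟨
  m ÷ suc d + 0                          ≡⟨ cong (m ÷ suc d +_) (𝟙-no (suc d ∣? suc m) ∤) ⟨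
  m ÷ suc d + 𝟙 (suc d ∣? suc m)         ∎
  where
  open ≡-Reasoning
  ∤ : ¬ suc d ∣ suc m
  ∤ (divides k eq) = contradiction
    (≤-pred (*-cancelʳ-< (suc d) k (suc q) (subst (_< suc q * suc d) eq lt)))
    (<⇒≱ (*-cancelʳ-< (suc d) q k (subst (q * suc d <_) eq (s≤s (÷-lower m (suc d))))))
    where q = m ÷ suc d

-- Powers and finite products

^-distribʳ-* : ∀ m n k → (m * n) ^ k ≡ m ^ k * n ^ k
^-distribʳ-* m n zero    = refl
^-distribʳ-* m n (suc k) = trans (cong (m * n *_) (^-distribʳ-* m n k)) ([m*n]*[o*p]≡[m*o]*[n*p] m n _ _)

1≤^ : ∀ {m} k → 1 ≤ m → 1 ≤ m ^ k
1≤^ {suc m} k _ = m^n>0 (suc m) k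

^-monoʳ : ∀ {m a b} → 1 ≤ m → a ≤ b → m ^ a ≤ m ^ b
^-monoʳ {suc m} _ = ^-monoʳ-≤ (suc m)

-- The index runs from 1 to n, which is why pointwise hypotheses are stated at `suc i` with i < n.
∏ : (ℕ → ℕ) → ℕ → ℕ
∏ f zero    = 1
∏ f (suc n) = ∏ f n * f (suc n)

∏-mono : ∀ {f g} n → (∀ i → i < n → f (suc i) ≤ g (suc i)) → ∏ f n ≤ ∏ g n
∏-mono zero    h = ≤-refl
∏-mono (suc n) h = *-mono-≤ (∏-mono n λ i i<n → h i (m≤n⇒m≤1+n i<n)) (h n ≤-refl)

∏-cong : ∀ {f g} n → (∀ i → i < n → f (suc i) ≡ g (suc i)) → ∏ f n ≡ ∏ g n
∏-cong zero    h = refl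
∏-cong (suc n) h = cong₂ _*_ (∏-cong n λ i i<n → h i (m≤n⇒m≤1+n i<n)) (h n ≤-refl)

∏-const-1 : ∀ n → ∏ (λ _ → 1) n ≡ 1
∏-const-1 zero    = refl
∏-const-1 (suc n) = trans (*-identityʳ _) (∏-const-1 n)

∏-* : ∀ f g n → ∏ (λ d → f d * g d) n ≡ ∏ f n * ∏ g n
∏-* f g zero    = refl
∏-* f g (suc n) = trans (cong (_* (f (suc n) * g (suc n))) (∏-* f g n)) ([m*n]*[o*p]≡[m*o]*[n*p] (∏ f n) _ _ _)

∏-^ : ∀ f k n → ∏ (λ d → f d ^ k) n ≡ ∏ f n ^ k
∏-^ f k zero    = sym (^-zeroˡ k)
∏-^ f k (suc n) = trans (cong (_* f (suc n) ^ k) (∏-^ f k n)) (sym (^-distribʳ-* (∏ f n) (f (suc n)) k))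

∏-^-+ : ∀ (f a b : ℕ → ℕ) n → ∏ (λ d → f d ^ (a d + b d)) n ≡ ∏ (λ d → f d ^ a d) n * ∏ (λ d → f d ^ b d) n
∏-^-+ f a b n = begin
  ∏ (λ d → f d ^ (a d + b d)) n                       ≡⟨ ∏-cong n (λ i _ → ^-distribˡ-+-* (f (suc i)) (a (suc i)) (b (suc i))) ⟩
  ∏ (λ d → f d ^ a d * f d ^ b d) n                   ≡⟨ ∏-* (λ d → f d ^ a d) (λ d → f d ^ b d) n ⟩
  ∏ (λ d → f d ^ a d) n * ∏ (λ d → f d ^ b d) n       ∎
  where open ≡-Reasoning

∏-swap : ∀ (f : ℕ → ℕ → ℕ) n m → ∏ (λ d → ∏ (f d) m) n ≡ ∏ (λ p → ∏ (λ d → f d p) n) m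
∏-swap f zero    m = sym (∏-const-1 m)
∏-swap f (suc n) m = trans (cong (_* ∏ (f (suc n)) m) (∏-swap f n m))
                           (sym (∏-* (λ p → ∏ (λ d → f d p) n) (f (suc n)) m))

^𝟙-yes : ∀ {ℓ} {A : Set ℓ} c (A? : Dec A) → A → c ^ 𝟙 A? ≡ c
^𝟙-yes c A? a = trans (cong (c ^_) (𝟙-yes A? a)) (^-identityʳ c)

^𝟙-no : ∀ {ℓ} {A : Set ℓ} c (A? : Dec A) → ¬ A → c ^ 𝟙 A? ≡ 1
^𝟙-no c A? ¬a = cong (c ^_) (𝟙-no A? ¬a)

-- Ranges are encoded as indicator exponents, so that products of different lengths can be compared
-- factor by factor over one common range.
∏-truncate : ∀ (f : ℕ → ℕ) {n m} → n ≤ m → ∏ (λ d → f d ^ 𝟙 (d ≤? n)) m ≡ ∏ f n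
∏-truncate f {n} {m} n≤m with m≤n⇒m<n∨m≡n n≤m
... | inj₂ refl = ∏-cong n λ i i<n → ^𝟙-yes (f (suc i)) (suc i ≤? n) i<n
∏-truncate f {n} {suc m} n≤m | inj₁ n<m =
  trans (cong₂ _*_ (∏-truncate f (≤-pred n<m)) (^𝟙-no (f (suc m)) (suc m ≤? n) (<⇒≱ n<m)))
        (*-identityʳ (∏ f n))

∏-point : ∀ (f : ℕ → ℕ) {e n} → 1 ≤ e → e ≤ n → ∏ (λ d → f d ^ 𝟙 (d ≟ e)) n ≡ f e
∏-point f {e} {zero}  1≤e e≤0 = contradiction (≤-trans 1≤e e≤0) λ ()
∏-point f {e} {suc n} 1≤e e≤n with m≤n⇒m<n∨m≡n e≤n
... | inj₁ e<n = trans
  (cong₂ _*_ (∏-point f 1≤e (≤-pred e<n)) (^𝟙-no (f (suc n)) (suc n ≟ e) λ { refl → <-irrefl refl e<n }))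
  (*-identityʳ (f e))
... | inj₂ refl = trans
  (cong₂ _*_
    (trans (∏-cong n λ i i<n → ^𝟙-no (f (suc i)) (suc i ≟ suc n) λ eq → <-irrefl (suc-injective eq) i<n)
           (∏-const-1 n))
    (^𝟙-yes (f (suc n)) (suc n ≟ suc n) refl))
  (*-identityˡ (f (suc n)))

-- The von Mangoldt function

prime⇒1< : ∀ {p} → Prime p → 1 < p
prime⇒1< {p} pp = nonTrivial⇒n>1 p {{prime⇒nonTrivial pp}}

prime⇒1≤ : ∀ {p} → Prime p → 1 ≤ p
prime⇒1≤ pp = <⇒≤ (prime⇒1< pp)

prime∤1 : ∀ {p} → Prime p → ¬ p ∣ 1
prime∤1 pp p∣1 = <⇒≢ (prime⇒1< pp) (sym (∣1⇒≡1 p∣1))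

prime∣prime⇒≡ : ∀ {p q} → Prime p → Prime q → p ∣ q → p ≡ q
prime∣prime⇒≡ pp pq p∣q with prime⇒irreducible pq p∣q
... | inj₁ p≡1 = contradiction (sym p≡1) (<⇒≢ (prime⇒1< pp))
... | inj₂ p≡q = p≡q

prime∣^⇒∣ : ∀ {p} m k → Prime p → p ∣ m ^ k → p ∣ m
prime∣^⇒∣ m zero    pp p∣1 = contradiction p∣1 (prime∤1 pp)
prime∣^⇒∣ m (suc k) pp p∣  with euclidsLemma m (m ^ k) pp p∣
... | inj₁ p∣m  = p∣m
... | inj₂ p∣mk = prime∣^⇒∣ m k pp p∣mk

primePower-base : ∀ {p q} k j → Prime p → Prime q → p ^ suc k ≡ q ^ suc j → p ≡ q
primePower-base {p} {q} k j pp pq eq =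
  prime∣prime⇒≡ pp pq (prime∣^⇒∣ q (suc j) pp (subst (p ∣_) eq (m∣m*n (p ^ k))))

n<m^n : ∀ {m} n → 1 < m → n < m ^ n
n<m^n zero    1<m = z<s
n<m^n {m} (suc n) 1<m = begin-strict
  suc n           ≤⟨ n<m^n n 1<m ⟩
  m ^ n           ≡⟨ *-identityˡ (m ^ n) ⟨
  1 * m ^ n       <⟨ *-monoˡ-< (m ^ n) {{>-nonZero (1≤^ n (<⇒≤ 1<m))}} 1<m ⟩
  m * m ^ n       ∎
  where open ≤-Reasoning

-- The bounds make the search finite and lose no prime power, because p ≤ p ^ (k + 1) and k < p ^ (k
-- + 1).
primePower? : ∀ d → Dec (∃[ p ] (p < suc d × Prime p × ∃[ k ] (k < d × d ≡ p ^ suc k)))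
primePower? d = anyUpTo? (λ p → prime? p ×-dec anyUpTo? (λ k → d ≟ p ^ suc k) d) (suc d)

abstract
  -- e ^ Λ(d)
  vm : ℕ → ℕ
  vm d with primePower? d
  ... | yes (p , _) = p
  ... | no  _       = 1

  -- As `vm` is abstract, all later facts about it are derived from this case distinction rather
  -- than from the search. The base found by the search is the only possible one by
  -- `primePower-base`.
  vm-cases : ∀ d → (vm d ≡ 1 × (∀ p k → Prime p → d ≢ p ^ suc k))
                 ⊎ (∃[ p ] ∃[ k ] (Prime p × d ≡ p ^ suc k × vm d ≡ p))
  vm-cases d with primePower? d
  ... | yes (p , _ , pp , k , _ , eq) = inj₂ (p , k , pp , eq , refl)
  ... | no ¬pp = inj₁ (refl , λ { p k pp refl → ¬pp (p , s≤s (m≤m*n p (p ^ k) {{>-nonZero (1≤^ k (prime⇒1≤ pp))}}) , pp , k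
                                   , <-trans (n<1+n k) (n<m^n (suc k) (prime⇒1< pp)) , refl) })

vm-primePower : ∀ {p} k → Prime p → vm (p ^ suc k) ≡ p
vm-primePower {p} k pp with vm-cases (p ^ suc k)
... | inj₁ (_ , ≢)               = contradiction refl (≢ p k pp)
... | inj₂ (q , j , pq , eq , e) = trans e (sym (primePower-base k j pp pq eq))

1≤vm : ∀ d → 1 ≤ vm d
1≤vm d with vm-cases d
... | inj₁ (e , _)              = ≤-reflexive (sym e)
... | inj₂ (p , k , pp , _ , e) = subst (1 ≤_) (sym e) (prime⇒1≤ pp)

vm-1 : vm 1 ≡ 1
vm-1 with vm-cases 1
... | inj₁ (e , _)               = e
... | inj₂ (p , k , pp , eq , _) = contradiction (subst (p ∣_) (sym eq) (m∣m*n (p ^ k))) (prime∤1 pp)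

extractPower : ∀ {p} m → Prime p → 1 ≤ m → ∃[ a ] ∃[ q ] (m ≡ p ^ a * q × ¬ p ∣ q)
extractPower {p} m pp = <-rec (λ m → 1 ≤ m → ∃[ a ] ∃[ q ] (m ≡ p ^ a * q × ¬ p ∣ q)) go m
  where
  go : ∀ m → (∀ {n} → n < m → 1 ≤ n → ∃[ a ] ∃[ q ] (n ≡ p ^ a * q × ¬ p ∣ q)) → 1 ≤ m → ∃[ a ] ∃[ q ] (m ≡ p ^ a * q × ¬ p ∣ q)
  go m rec 1≤m with p ∣? m
  ... | no p∤m = 0 , m , sym (*-identityˡ m) , p∤m
  ... | yes (divides zero refl) = contradiction 1≤m λ ()
  ... | yes (divides n@(suc _) refl) with rec (m<m*n n p (prime⇒1< pp)) z<s
  ...   | a , q , eq , p∤q = suc a , q , trans (cong (_* p) eq) (shuffle (p ^ a) q p) , p∤q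
    where
    shuffle : ∀ x q p → x * q * p ≡ p * x * q
    shuffle = solve-∀

-- By Euclid's lemma each factor r must come out of m, and they are cancelled one at a time.
^∣*⇒^∣ : ∀ {p r} k m → Prime p → Prime r → r ≢ p → r ^ k ∣ p * m → r ^ k ∣ m
^∣*⇒^∣ zero m pp pr r≢p _ = 1∣ m
^∣*⇒^∣ {p} {r} (suc k) m pp pr r≢p r^∣ with euclidsLemma p m pr (∣-trans (m∣m*n (r ^ k)) r^∣)
... | inj₁ r∣p = contradiction (prime∣prime⇒≡ pr pp r∣p) r≢p
... | inj₂ (divides n refl) = subst (r * r ^ k ∣_) (*-comm r n) (*-monoʳ-∣ r (^∣*⇒^∣ k n pp pr r≢p
      (*-cancelˡ-∣ r {{prime⇒nonZero pr}} (subst (r * r ^ k ∣_) (shuffle p n r) r^∣))))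
  where
  shuffle : ∀ p n r → p * (n * r) ≡ r * (p * n)
  shuffle = solve-∀

-- Passing from m to p * m adds a single prime power to the divisors, the next power of p.
vm-divisor-step : ∀ {p} a q d → Prime p → ¬ p ∣ q → let m = p ^ a * q in
  vm d ^ 𝟙 (d ∣? p * m) ≡ vm d ^ 𝟙 (d ∣? m) * vm d ^ 𝟙 (d ≟ p ^ suc a)
vm-divisor-step {p} a q d pp p∤q = by-cases (d ∣? m) (d ≟ p ^ suc a) (d ∣? p * m)
  where
  open ≡-Reasoning
  m = p ^ a * q
  instance
    p≢0 : NonZero p
    p≢0 = prime⇒nonZero pp
  1≤p = prime⇒1≤ pp

  next∤m : ¬ p ^ suc a ∣ m
  next∤m h = p∤q (*-cancelˡ-∣ (p ^ a) {{>-nonZero (1≤^ a 1≤p)}} (subst (_∣ m) (*-comm p (p ^ a)) h))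

  next∣pm : p ^ suc a ∣ p * m
  next∣pm = *-monoʳ-∣ p (m∣m*n q)

  ^-∣ : ∀ {k l} → k ≤ l → p ^ k ∣ p ^ l
  ^-∣ {k} {l} k≤l = subst (λ e → p ^ k ∣ p ^ e) (m+[n∸m]≡n k≤l)
    (subst (p ^ k ∣_) (sym (^-distribˡ-+-* p k (l ∸ k))) (m∣m*n (p ^ (l ∸ k))))

  vm≡1 : ¬ d ∣ m → d ≢ p ^ suc a → d ∣ p * m → vm d ≡ 1
  vm≡1 d∤m d≢ d∣pm with vm-cases d
  ... | inj₁ (e , _) = e
  ... | inj₂ (r , k , pr , refl , _) with r ≟ p
  ...   | no r≢p = contradiction (^∣*⇒^∣ (suc k) m pp pr r≢p d∣pm) d∤m
  -- Here d = p ^ (k + 1). If k < a it divides m already, if k = a it is the new prime power, and if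
  -- k > a then cancelling one p would give p ^ (a + 1) ∣ m.
  ...   | yes refl with <-cmp k a
  ...     | tri< k<a _ _  = contradiction (∣-trans (^-∣ k<a) (m∣m*n q)) d∤m
  ...     | tri≈ _ refl _ = contradiction refl d≢
  ...     | tri> _ _ a<k  = contradiction
              (*-cancelˡ-∣ p (∣-trans (^-∣ (s≤s a<k)) d∣pm)) next∤m

  by-cases : Dec (d ∣ m) → Dec (d ≡ p ^ suc a) → Dec (d ∣ p * m) →
             vm d ^ 𝟙 (d ∣? p * m) ≡ vm d ^ 𝟙 (d ∣? m) * vm d ^ 𝟙 (d ≟ p ^ suc a)
  by-cases (yes d∣m) (yes refl) _ = contradiction d∣m next∤m
  by-cases (yes d∣m) (no d≢) _ = trans (^𝟙-yes (vm d) (d ∣? p * m) (∣n⇒∣m*n p d∣m))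
    (sym (trans (cong₂ _*_ (^𝟙-yes (vm d) (d ∣? m) d∣m) (^𝟙-no (vm d) (d ≟ p ^ suc a) d≢)) (*-identityʳ (vm d))))
  by-cases (no d∤m) (yes d≡) _ = trans (^𝟙-yes (vm d) (d ∣? p * m) (subst (_∣ p * m) (sym d≡) next∣pm))
    (sym (trans (cong₂ _*_ (^𝟙-no (vm d) (d ∣? m) d∤m) (^𝟙-yes (vm d) (d ≟ p ^ suc a) d≡)) (*-identityˡ (vm d))))
  by-cases (no d∤m) (no d≢) (no d∤pm) = trans (^𝟙-no (vm d) (d ∣? p * m) d∤pm)
    (sym (cong₂ _*_ (^𝟙-no (vm d) (d ∣? m) d∤m) (^𝟙-no (vm d) (d ≟ p ^ suc a) d≢)))
  by-cases (no d∤m) (no d≢) (yes d∣pm) = trans (trans (^𝟙-yes (vm d) (d ∣? p * m) d∣pm) (vm≡1 d∤m d≢ d∣pm))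
    (sym (cong₂ _*_ (^𝟙-no (vm d) (d ∣? m) d∤m) (^𝟙-no (vm d) (d ≟ p ^ suc a) d≢)))

-- This is Σ_{d ∣ m} Λ(d) = log m, by induction on the prime factors of m: a further factor p adds
-- just one prime power to the divisors, and that one contributes p.
∏-vm-divisors-product : ∀ ps M → All Prime ps → product ps ≤ M →
  ∏ (λ d → vm d ^ 𝟙 (d ∣? product ps)) M ≡ product ps
∏-vm-divisors-product [] M [] _ = trans (∏-cong M pointwise) (∏-const-1 M)
  where
  pointwise : ∀ i → i < M → vm (suc i) ^ 𝟙 (suc i ∣? 1) ≡ 1
  pointwise zero    _ = trans (^𝟙-yes (vm 1) (1 ∣? 1) ∣-refl) vm-1
  pointwise (suc i) _ = ^𝟙-no (vm (suc (suc i))) (suc (suc i) ∣? 1) λ h → contradiction (∣1⇒≡1 h) λ ()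
∏-vm-divisors-product (p ∷ ps) M (pp ∷ pps) pm≤M
  with extractPower (product ps) pp (productOfPrimes≥1 pps) | ∏-vm-divisors-product ps M pps
... | a , q , eq , p∤q | ih = begin
  ∏ (λ d → vm d ^ 𝟙 (d ∣? p * m)) M
    ≡⟨ ∏-cong M (λ i _ → step i) ⟩
  ∏ (λ d → vm d ^ 𝟙 (d ∣? m) * vm d ^ 𝟙 (d ≟ p ^ suc a)) M
    ≡⟨ ∏-* (λ d → vm d ^ 𝟙 (d ∣? m)) (λ d → vm d ^ 𝟙 (d ≟ p ^ suc a)) M ⟩
  ∏ (λ d → vm d ^ 𝟙 (d ∣? m)) M * ∏ (λ d → vm d ^ 𝟙 (d ≟ p ^ suc a)) M
    ≡⟨ cong₂ _*_ (ih (≤-trans (m≤n*m m p {{prime⇒nonZero pp}}) pm≤M))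
         (trans (∏-point vm (1≤^ (suc a) (prime⇒1≤ pp)) next≤M) (vm-primePower a pp)) ⟩
  m * p
    ≡⟨ *-comm m p ⟩
  p * m ∎
  where
  open ≡-Reasoning
  m = product ps
  step : ∀ i → vm (suc i) ^ 𝟙 (suc i ∣? p * m) ≡ vm (suc i) ^ 𝟙 (suc i ∣? m) * vm (suc i) ^ 𝟙 (suc i ≟ p ^ suc a)
  step i = subst (λ m → vm (suc i) ^ 𝟙 (suc i ∣? p * m) ≡ vm (suc i) ^ 𝟙 (suc i ∣? m) * vm (suc i) ^ 𝟙 (suc i ≟ p ^ suc a))
                 (sym eq) (vm-divisor-step a q (suc i) pp p∤q)
  -- The new prime power must lie in the range of the product for `∏-point` to pick it up. It does,
  -- as it divides p * m; here q ≠ 0 because p ∤ q.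
  next≤M : p ^ suc a ≤ M
  next≤M = ≤-trans (*-monoʳ-≤ p (subst (p ^ a ≤_) (sym eq) (m≤m*n (p ^ a) q {{≢-nonZero λ { refl → p∤q (_ ∣0) }}}))) pm≤M

∏-vm-divisors : ∀ m {M} → suc m ≤ M → ∏ (λ d → vm d ^ 𝟙 (d ∣? suc m)) M ≡ suc m
∏-vm-divisors m {M} m≤M with factorise (suc m)
... | record { factors = ps ; isFactorisation = eq ; factorsPrime = pps } =
  subst (λ m → m ≤ M → ∏ (λ d → vm d ^ 𝟙 (d ∣? m)) M ≡ m) (sym eq) (∏-vm-divisors-product ps M pps) m≤M

-- Sum the divisor identity over all numbers up to m. The upper end M is left free so that several
-- factorials can share one range.
!-as-∏ : ∀ m {M} → m ≤ M → m ! ≡ ∏ (λ d → vm d ^ (m ÷ d)) M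
!-as-∏ zero {M} _ = sym (trans (∏-cong M λ i _ → cong (vm (suc i) ^_) (0÷ (suc i))) (∏-const-1 M))
!-as-∏ (suc m) {M} m<M = begin
  suc m * m !                                                               ≡⟨ *-comm (suc m) (m !) ⟩
  m ! * suc m                                                               ≡⟨ cong₂ _*_ (!-as-∏ m (<⇒≤ m<M)) (sym (∏-vm-divisors m m<M)) ⟩
  ∏ (λ d → vm d ^ (m ÷ d)) M * ∏ (λ d → vm d ^ 𝟙 (d ∣? suc m)) M            ≡⟨ ∏-^-+ vm (m ÷_) (λ d → 𝟙 (d ∣? suc m)) M ⟨
  ∏ (λ d → vm d ^ (m ÷ d + 𝟙 (d ∣? suc m))) M                               ≡⟨ ∏-cong M (λ i _ → cong (vm (suc i) ^_) (sym (÷-suc m i))) ⟩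
  ∏ (λ d → vm d ^ (suc m ÷ d)) M                                            ∎
  where open ≡-Reasoning

∏-vm-mono : ∀ (a b : ℕ → ℕ) n → (∀ i → i < n → a (suc i) ≤ b (suc i)) →
            ∏ (λ d → vm d ^ a d) n ≤ ∏ (λ d → vm d ^ b d) n
∏-vm-mono a b n h = ∏-mono n λ i i<n → ^-monoʳ (1≤vm (suc i)) (h i i<n)

-- Chebyshev's bound ψ(n) ≤ n log 4

Ψ : ℕ → ℕ
Ψ = ∏ vm

-- For d ≤ k the floor function is superadditive. For k < d ≤ m + k both quotients on the left
-- vanish, while the one of m + k is at least 1.
binomial-exponent : ∀ {m k} i → m ≤ k → i < m + k →
  1 + (m ÷ suc i + k ÷ suc i) ≤ 𝟙 (suc i ≤? k) + (m + k) ÷ suc i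
binomial-exponent {m} {k} i m≤k i<n with suc i ≤? k
... | yes d≤k = begin
  1 + (m ÷ suc i + k ÷ suc i)               ≤⟨ s≤s (÷-superadditive m k (suc i)) ⟩
  1 + (m + k) ÷ suc i                       ≡⟨ cong (_+ (m + k) ÷ suc i) (𝟙-yes (suc i ≤? k) d≤k) ⟨
  𝟙 (suc i ≤? k) + (m + k) ÷ suc i          ∎
  where open ≤-Reasoning
... | no d≰k = begin
  1 + (m ÷ suc i + k ÷ suc i)               ≡⟨ cong suc (cong₂ _+_ (<⇒÷≡0 (≤-<-trans m≤k (≰⇒> d≰k))) (<⇒÷≡0 (≰⇒> d≰k))) ⟩
  1                                         ≤⟨ ÷-greatest i (subst (_≤ m + k) (sym (*-identityˡ (suc i))) i<n) ⟩
  (m + k) ÷ suc i                           ≤⟨ m≤n+m _ (𝟙 (suc i ≤? k)) ⟩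
  𝟙 (suc i ≤? k) + (m + k) ÷ suc i          ∎
  where open ≤-Reasoning

-- In logarithms, ψ(m + k) - ψ(k) is at most the logarithm of the binomial coefficient of m + k over
-- k. The denominators are cleared to stay in ℕ.
Ψ-binomial : ∀ {m k} → m ≤ k → Ψ (m + k) * (m ! * k !) ≤ Ψ k * (m + k) !
Ψ-binomial {m} {k} m≤k = begin
  Ψ n * (m ! * k !)
    ≡⟨ cong₂ _*_ (∏-cong n λ i _ → sym (*-identityʳ (vm (suc i))))
         (cong₂ _*_ (!-as-∏ m (m≤m+n m k)) (!-as-∏ k (m≤n+m k m))) ⟩
  ∏ (λ d → vm d ^ 1) n * (∏ (λ d → vm d ^ (m ÷ d)) n * ∏ (λ d → vm d ^ (k ÷ d)) n)
    ≡⟨ cong (∏ (λ d → vm d ^ 1) n *_) (∏-^-+ vm (m ÷_) (k ÷_) n) ⟨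
  ∏ (λ d → vm d ^ 1) n * ∏ (λ d → vm d ^ (m ÷ d + k ÷ d)) n
    ≡⟨ ∏-^-+ vm (λ _ → 1) (λ d → m ÷ d + k ÷ d) n ⟨
  ∏ (λ d → vm d ^ (1 + (m ÷ d + k ÷ d))) n
    ≤⟨ ∏-vm-mono (λ d → 1 + (m ÷ d + k ÷ d)) (λ d → 𝟙 (d ≤? k) + n ÷ d) n (λ i → binomial-exponent i m≤k) ⟩
  ∏ (λ d → vm d ^ (𝟙 (d ≤? k) + n ÷ d)) n
    ≡⟨ ∏-^-+ vm (λ d → 𝟙 (d ≤? k)) (n ÷_) n ⟩
  ∏ (λ d → vm d ^ 𝟙 (d ≤? k)) n * ∏ (λ d → vm d ^ (n ÷ d)) n
    ≡⟨ cong₂ _*_ (∏-truncate vm (m≤n+m k m)) (sym (!-as-∏ n ≤-refl)) ⟩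
  Ψ k * n ! ∎
  where
  open ≤-Reasoning
  n = m + k

-- The induction step replaces the factor 2m + 1 by 2m + 2, which turns the ratio of consecutive
-- central binomial coefficients into exactly 4.
even-central : ∀ m → (m + m) ! ≤ 4 ^ m * (m ! * m !)
even-central zero    = ≤-refl
even-central (suc m) = begin
  suc (m + suc m) * (m + suc m) !                          ≡⟨ cong (λ l → suc l * l !) (+-suc m m) ⟩
  suc (suc (m + m)) * (suc (m + m) * (m + m) !)            ≡⟨ *-assoc (2 + (m + m)) (1 + (m + m)) _ ⟨
  (2 + (m + m)) * (1 + (m + m)) * (m + m) !                ≤⟨ *-mono-≤ (*-monoʳ-≤ (2 + (m + m)) (n≤1+n (1 + (m + m)))) (even-central m) ⟩
  (2 + (m + m)) * (2 + (m + m)) * (4 ^ m * (m ! * m !))    ≡⟨ shuffle m (4 ^ m) (m !) ⟩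
  4 * 4 ^ m * (suc m * m ! * (suc m * m !))                ∎
  where
  open ≤-Reasoning
  shuffle : ∀ m x y → (2 + (m + m)) * (2 + (m + m)) * (x * (y * y)) ≡ 4 * x * (suc m * y * (suc m * y))
  shuffle = solve-∀

-- As in the even case, now with 2m + 3 replaced by 2m + 4.
odd-central : ∀ m → (m + suc m) ! ≤ 4 ^ m * (m ! * suc m !)
odd-central zero    = ≤-refl
odd-central (suc m) = begin
  suc (m + suc (suc m)) * (m + suc (suc m)) !                        ≡⟨ cong (λ l → suc l * l !) (+-suc m (suc m)) ⟩
  suc (suc (m + suc m)) * (suc (m + suc m) * (m + suc m) !)          ≡⟨ *-assoc (2 + (m + suc m)) (1 + (m + suc m)) _ ⟨
  (2 + (m + suc m)) * (1 + (m + suc m)) * (m + suc m) !              ≤⟨ *-mono-≤ (*-monoˡ-≤ (1 + (m + suc m)) (n≤1+n (2 + (m + suc m)))) (odd-central m) ⟩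
  (3 + (m + suc m)) * (1 + (m + suc m)) * (4 ^ m * (m ! * suc m !))  ≡⟨ shuffle m (4 ^ m) (m !) (suc m !) ⟩
  4 * 4 ^ m * (suc m * m ! * (suc (suc m) * suc m !))                ∎
  where
  open ≤-Reasoning
  shuffle : ∀ m x y z → (3 + (m + suc m)) * (1 + (m + suc m)) * (x * (y * z)) ≡ 4 * x * (suc m * y * (suc (suc m) * z))
  shuffle = solve-∀

even-or-odd : ∀ n → ∃[ m ] (n ≡ m + m ⊎ n ≡ m + suc m)
even-or-odd zero = 0 , inj₁ refl
even-or-odd (suc n) with even-or-odd n
... | m , inj₁ refl = m , inj₂ (sym (+-suc m m))
... | m , inj₂ refl = suc m , inj₁ refl

Ψ≤4^ : ∀ n → Ψ n ≤ 4 ^ n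
Ψ≤4^ = <-rec (λ n → Ψ n ≤ 4 ^ n) go
  where
  open ≤-Reasoning
  halve : ∀ {m k} → m ≤ k → (m + k) ! ≤ 4 ^ m * (m ! * k !) → Ψ k ≤ 4 ^ k → Ψ (m + k) ≤ 4 ^ (m + k)
  halve {m} {k} m≤k central Ψk≤ = *-cancelʳ-≤ _ _ (m ! * k !) {{m*n≢0 (m !) (k !) {{m !≢0}} {{k !≢0}}}} (begin
    Ψ (m + k) * (m ! * k !)             ≤⟨ Ψ-binomial m≤k ⟩
    Ψ k * (m + k) !                     ≤⟨ *-mono-≤ Ψk≤ central ⟩
    4 ^ k * (4 ^ m * (m ! * k !))       ≡⟨ *-assoc (4 ^ k) (4 ^ m) _ ⟨
    4 ^ k * 4 ^ m * (m ! * k !)         ≡⟨ cong (_* (m ! * k !)) (trans (*-comm (4 ^ k) (4 ^ m)) (sym (^-distribˡ-+-* 4 m k))) ⟩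
    4 ^ (m + k) * (m ! * k !)           ∎)
  go : ∀ n → (∀ {k} → k < n → Ψ k ≤ 4 ^ k) → Ψ n ≤ 4 ^ n
  go n rec with even-or-odd n
  ... | zero  , inj₁ refl = ≤-refl
  -- For n = 1 the larger half would be 1 itself, so the recursion does not apply.
  ... | zero  , inj₂ refl = begin
    1 * vm 1  ≡⟨ cong (1 *_) vm-1 ⟩
    1         ≤⟨ s≤s z≤n ⟩
    4         ∎
  ... | suc m , inj₁ refl = halve {suc m} ≤-refl (even-central (suc m)) (rec (m<n+m (suc m) z<s))
  ... | suc m , inj₂ refl = halve {suc m} (n≤1+n (suc m)) (odd-central (suc m)) (rec (m<n+m (suc (suc m)) z<s))

-- Products of factorials

-- A pair (j , b) stands for the factor ⌊x/j⌋! ^ (j * b).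
weight : List (ℕ × ℕ) → ℕ → ℕ
weight []             z = 0
weight ((j , b) ∷ js) z = j * b * (z ÷ j) + weight js z

factorials : ℕ → List (ℕ × ℕ) → ℕ
factorials x []             = 1
factorials x ((j , b) ∷ js) = ((x ÷ j) !) ^ (j * b) * factorials x js

÷≤ : ∀ x d → x ÷ d ≤ x
÷≤ x zero    = z≤n
÷≤ x (suc d) = m/n≤m x (suc d)

∏-vm-^ : ∀ (a : ℕ → ℕ) k n → ∏ (λ d → vm d ^ (k * a d)) n ≡ ∏ (λ d → vm d ^ a d) n ^ k
∏-vm-^ a k n = trans
  (∏-cong n λ i _ → trans (cong (vm (suc i) ^_) (*-comm k (a (suc i)))) (sym (^-*-assoc (vm (suc i)) (a (suc i)) k)))
  (∏-^ (λ d → vm d ^ a d) k n)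

factorials-as-∏ : ∀ x js → factorials x js ≡ ∏ (λ d → vm d ^ weight js (x ÷ d)) x
factorials-as-∏ x []             = sym (∏-const-1 x)
factorials-as-∏ x ((j , b) ∷ js) = begin
  ((x ÷ j) !) ^ (j * b) * factorials x js
    ≡⟨ cong₂ _*_ (cong (_^ (j * b)) (trans (!-as-∏ (x ÷ j) (÷≤ x j))
                    (∏-cong x λ i _ → cong (vm (suc i) ^_) (÷-comm x j (suc i)))))
                 (factorials-as-∏ x js) ⟩
  ∏ (λ d → vm d ^ ((x ÷ d) ÷ j)) x ^ (j * b) * ∏ (λ d → vm d ^ weight js (x ÷ d)) x
    ≡⟨ cong (_* ∏ (λ d → vm d ^ weight js (x ÷ d)) x) (∏-vm-^ (λ d → (x ÷ d) ÷ j) (j * b) x) ⟨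
  ∏ (λ d → vm d ^ (j * b * ((x ÷ d) ÷ j))) x * ∏ (λ d → vm d ^ weight js (x ÷ d)) x
    ≡⟨ ∏-^-+ vm (λ d → j * b * ((x ÷ d) ÷ j)) (λ d → weight js (x ÷ d)) x ⟨
  ∏ (λ d → vm d ^ weight ((j , b) ∷ js) (x ÷ d)) x ∎
  where open ≡-Reasoning

-- A pair (t , u) stands for a jump of height u at t + 1.
step : List (ℕ × ℕ) → ℕ → ℕ
step []             z = 0
step ((t , u) ∷ us) z = u * 𝟙 (t <? z) + step us z

stepTotal : List (ℕ × ℕ) → ℕ → ℕ
stepTotal []             x = 0
stepTotal ((t , u) ∷ us) x = x ÷ suc t * u + stepTotal us x

-- The condition t < ⌊x/d⌋ means d ≤ ⌊x/(t + 1)⌋, so a jump of height u contributes u ψ(x/(t + 1)),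
-- to which Chebyshev's bound applies.
∏-vm-step : ∀ x us → ∏ (λ d → vm d ^ step us (x ÷ d)) x ≤ 4 ^ stepTotal us x
∏-vm-step x [] = ≤-reflexive (∏-const-1 x)
∏-vm-step x ((t , u) ∷ us) = begin
  ∏ (λ d → vm d ^ (u * 𝟙 (t <? x ÷ d) + step us (x ÷ d))) x
    ≡⟨ ∏-^-+ vm (λ d → u * 𝟙 (t <? x ÷ d)) (λ d → step us (x ÷ d)) x ⟩
  ∏ (λ d → vm d ^ (u * 𝟙 (t <? x ÷ d))) x * ∏ (λ d → vm d ^ step us (x ÷ d)) x
    ≤⟨ *-mono-≤ (begin
         ∏ (λ d → vm d ^ (u * 𝟙 (t <? x ÷ d))) x      ≡⟨ ∏-vm-^ (λ d → 𝟙 (t <? x ÷ d)) u x ⟩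
         ∏ (λ d → vm d ^ 𝟙 (t <? x ÷ d)) x ^ u        ≤⟨ ^-monoˡ-≤ u (∏-vm-mono (λ d → 𝟙 (t <? x ÷ d)) (λ d → 𝟙 (d ≤? x ÷ suc t)) x λ i _ → exponent i) ⟩
         ∏ (λ d → vm d ^ 𝟙 (d ≤? x ÷ suc t)) x ^ u    ≡⟨ cong (_^ u) (∏-truncate vm (÷≤ x (suc t))) ⟩
         Ψ (x ÷ suc t) ^ u                            ≤⟨ ^-monoˡ-≤ u (Ψ≤4^ (x ÷ suc t)) ⟩
         (4 ^ (x ÷ suc t)) ^ u                        ≡⟨ ^-*-assoc 4 (x ÷ suc t) u ⟩
         4 ^ (x ÷ suc t * u)                          ∎)
       (∏-vm-step x us) ⟩
  4 ^ (x ÷ suc t * u) * 4 ^ stepTotal us x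
    ≡⟨ ^-distribˡ-+-* 4 (x ÷ suc t * u) (stepTotal us x) ⟨
  4 ^ (x ÷ suc t * u + stepTotal us x) ∎
  where
  open ≤-Reasoning
  exponent : ∀ i → 𝟙 (t <? x ÷ suc i) ≤ 𝟙 (suc i ≤? x ÷ suc t)
  exponent i with suc i ≤? x ÷ suc t
  ... | yes d≤ = subst (𝟙 (t <? x ÷ suc i) ≤_) (sym (𝟙-yes (suc i ≤? x ÷ suc t) d≤)) (𝟙≤1 (t <? x ÷ suc i))
  ... | no d≰  = ≤-trans (≤-reflexive (𝟙-no (t <? x ÷ suc i) λ t< → d≰ (÷-greatest t (begin
    suc i * suc t            ≡⟨ *-comm (suc i) (suc t) ⟩
    suc t * suc i            ≤⟨ *-monoˡ-≤ (suc i) t< ⟩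
    x ÷ suc i * suc i        ≤⟨ ÷-lower x (suc i) ⟩
    x                        ∎)))) z≤n

-- Prime powers between 8 n and 9 n

∏-factor≤ : ∀ f {e n} → (∀ i → 1 ≤ f (suc i)) → 1 ≤ e → e ≤ n → f e ≤ ∏ f n
∏-factor≤ f {e} {n} 1≤f 1≤e e≤n = begin
  f e                                  ≡⟨ ∏-point f 1≤e e≤n ⟨
  ∏ (λ d → f d ^ 𝟙 (d ≟ e)) n          ≤⟨ ∏-mono n (λ i _ → ^-monoʳ (1≤f i) (𝟙≤1 (suc i ≟ e))) ⟩
  ∏ (λ d → f d ^ 1) n                  ≡⟨ ∏-cong n (λ i _ → ^-identityʳ (f (suc i))) ⟩
  ∏ f n                                ∎
  where open ≤-Reasoning

∏-bound : ∀ {f c} n → (∀ i → i < n → f (suc i) ≤ c) → ∏ f n ≤ c ^ n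
∏-bound zero    h = ≤-refl
∏-bound {f} {c} (suc n) h = subst (∏ f n * f (suc n) ≤_) (*-comm (c ^ n) c)
  (*-mono-≤ (∏-bound n λ i i<n → h i (m≤n⇒m≤1+n i<n)) (h n ≤-refl))

∏-unique≤ : ∀ {ℓ} {R : ℕ → Set ℓ} (R? : ∀ d → Dec (R d)) c n → 1 ≤ c →
            (∀ {d e} → R d → R e → d ≡ e) → ∏ (λ d → c ^ 𝟙 (R? d)) n ≤ c
∏-unique≤ R? c zero    1≤c _ = 1≤c
∏-unique≤ R? c (suc n) 1≤c unique with R? (suc n)
... | no ¬r = ≤-trans (≤-reflexive (*-identityʳ _))
                      (∏-unique≤ R? c n 1≤c unique)
... | yes r = ≤-reflexive (trans
  (cong₂ _*_ (trans (∏-cong n λ i i<n → ^𝟙-no c (R? (suc i)) λ r′ → <-irrefl (suc-injective (unique r′ r)) i<n) (∏-const-1 n))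
             (^-identityʳ c))
  (*-identityˡ c))

module PrimePowers (n s : ℕ) (9n<s² : 9 * n < suc s * suc s)
                   (noPrime : ∀ p → Prime p → 8 * n < p → ¬ p < 9 * n) where

  PowerIn : ℕ → ℕ → Set
  PowerIn p d = (8 * n < d × d ≤ 9 * n) × ∃[ k ] (k < d × d ≡ p ^ k)

  powerIn? : ∀ p d → Dec (PowerIn p d)
  powerIn? p d = ((8 * n <? d) ×-dec (d ≤? 9 * n)) ×-dec anyUpTo? (λ k → d ≟ p ^ k) d

  -- Distinct powers of a base at least 2 differ by a factor of at least 2 > 9/8, so they do not
  -- both fit in the interval. For base 1 all powers coincide.
  lessPowers : ∀ p {k l} → k < l → 8 * n < suc p ^ k → suc p ^ l ≤ 9 * n → suc p ^ k ≡ suc p ^ l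
  lessPowers zero    {k} {l} _ _ _ = trans (^-zeroˡ k) (sym (^-zeroˡ l))
  lessPowers (suc p) {k} {l} k<l lo hi = contradiction hi (<⇒≱ (begin-strict
    9 * n                                 ≤⟨ *-monoˡ-≤ n (m≤m+n 9 7) ⟩
    16 * n                                ≡⟨ *-assoc 2 8 n ⟩
    2 * (8 * n)                           <⟨ *-monoʳ-< 2 lo ⟩
    2 * suc (suc p) ^ k                   ≤⟨ *-monoˡ-≤ (suc (suc p) ^ k) (s≤s (s≤s (z≤n {p}))) ⟩
    suc (suc p) ^ suc k                   ≤⟨ ^-monoʳ-≤ (suc (suc p)) k<l ⟩
    suc (suc p) ^ l                       ∎))
    where open ≤-Reasoning

  unique : ∀ p {d e} → PowerIn (suc p) d → PowerIn (suc p) e → d ≡ e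
  unique p ((lo , hi) , k , _ , refl) ((lo′ , hi′) , l , _ , refl) with <-cmp k l
  ... | tri< k<l _ _  = lessPowers p k<l lo hi′
  ... | tri≈ _ refl _ = refl
  ... | tri> _ _ l<k  = sym (lessPowers p l<k lo′ hi)

  -- The condition ⌊72n/d⌋ = 8 also admits d = 9n, which the strict inequality p < 9n excludes; this
  -- end is no prime.
  9n-composite : ∀ {p} → Prime p → p ≢ 9 * n
  9n-composite pp refl = contradiction (prime∣prime⇒≡ prime[3] pp (subst (3 ∣_) (sym (*-assoc 3 3 n)) (m∣m*n (3 * n)))) (3≢ n)
    where
    prime[3] : Prime 3
    prime[3] = prime (λ { (composite {2} _ 2∣3) → contradiction (∣m+n∣m⇒∣n {m = 2} {n = 1} 2∣3 ∣-refl) (prime∤1 prime[2])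
                        ; (composite {suc (suc (suc _))} (s≤s (s≤s (s≤s ()))) _) })
    3≢ : ∀ n → 3 ≢ 9 * n
    3≢ zero ()
    3≢ (suc n) eq = contradiction (subst (9 ≤_) (sym eq) (m≤m*n 9 (suc n))) λ { (s≤s (s≤s (s≤s ()))) }

  ÷≡8⇒ : ∀ i → (72 * n) ÷ suc i ≡ 8 → 8 * n < suc i × suc i ≤ 9 * n
  ÷≡8⇒ i eq = *-cancelˡ-< 9 _ _ (begin-strict
      9 * (8 * n)                                ≡⟨ *-assoc 9 8 n ⟨
      72 * n                                     <⟨ ÷-upper (72 * n) i ⟩
      suc ((72 * n) ÷ suc i) * suc i             ≡⟨ cong (λ q → suc q * suc i) eq ⟩
      9 * suc i                                  ∎)
    , *-cancelˡ-≤ 8 (begin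
      8 * suc i                                  ≡⟨ cong (_* suc i) eq ⟨
      (72 * n) ÷ suc i * suc i                   ≤⟨ ÷-lower (72 * n) (suc i) ⟩
      72 * n                                     ≡⟨ *-assoc 8 9 n ⟩
      8 * (9 * n)                                ∎)
    where open ≤-Reasoning

  pointwise : ∀ i → vm (suc i) ^ 𝟙 ((72 * n) ÷ suc i ≟ 8) ≤ ∏ (λ p → p ^ 𝟙 (powerIn? p (suc i))) s
  pointwise i = by-cases ((72 * n) ÷ suc i ≟ 8) (vm-cases (suc i))
    where
    1≤∏ : 1 ≤ ∏ (λ p → p ^ 𝟙 (powerIn? p (suc i))) s
    1≤∏ = subst (_≤ ∏ (λ p → p ^ 𝟙 (powerIn? p (suc i))) s) (∏-const-1 s)
                (∏-mono s λ p _ → 1≤^ (𝟙 (powerIn? (suc p) (suc i))) (s≤s z≤n))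
    by-cases : Dec ((72 * n) ÷ suc i ≡ 8) → _ →
               vm (suc i) ^ 𝟙 ((72 * n) ÷ suc i ≟ 8) ≤ ∏ (λ p → p ^ 𝟙 (powerIn? p (suc i))) s
    by-cases (no ≢8) _ = subst (_≤ ∏ (λ p → p ^ 𝟙 (powerIn? p (suc i))) s) (sym (^𝟙-no (vm (suc i)) ((72 * n) ÷ suc i ≟ 8) ≢8)) 1≤∏
    by-cases (yes ≡8) (inj₁ (vm≡1 , _)) =
      subst (_≤ ∏ (λ p → p ^ 𝟙 (powerIn? p (suc i))) s) (sym (trans (^𝟙-yes (vm (suc i)) ((72 * n) ÷ suc i ≟ 8) ≡8) vm≡1)) 1≤∏
    -- Exponent 1: d is itself a prime of the interval, which `noPrime` forbids.
    by-cases (yes ≡8) (inj₂ (p , zero , pp , d≡p , _)) = contradiction p<9n (noPrime p pp 8n<p)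
      where
      d≡ : suc i ≡ p
      d≡ = trans d≡p (^-identityʳ p)
      8n<p = subst (8 * n <_) d≡ (proj₁ (÷≡8⇒ i ≡8))
      p<9n = ≤∧≢⇒< (subst (_≤ 9 * n) d≡ (proj₂ (÷≡8⇒ i ≡8))) (9n-composite pp)
    by-cases (yes ≡8) (inj₂ (p , suc k , pp , d≡p^ , vm≡p)) = begin
      vm (suc i) ^ 𝟙 ((72 * n) ÷ suc i ≟ 8)       ≡⟨ trans (^𝟙-yes (vm (suc i)) ((72 * n) ÷ suc i ≟ 8) ≡8) vm≡p ⟩
      p                                           ≡⟨ ^𝟙-yes p (powerIn? p (suc i)) powerIn ⟨
      p ^ 𝟙 (powerIn? p (suc i))                  ≤⟨ ∏-factor≤ (λ p → p ^ 𝟙 (powerIn? p (suc i)))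
                                                       (λ q → 1≤^ (𝟙 (powerIn? (suc q) (suc i))) (s≤s z≤n)) (prime⇒1≤ pp) p≤s ⟩
      ∏ (λ p → p ^ 𝟙 (powerIn? p (suc i))) s      ∎
      where
      open ≤-Reasoning
      bounds = ÷≡8⇒ i ≡8
      powerIn : PowerIn p (suc i)
      powerIn = bounds , suc (suc k) , subst (suc (suc k) <_) (sym d≡p^) (n<m^n (suc (suc k)) (prime⇒1< pp)) , d≡p^
      -- The exponent is at least 2, so p² ≤ d ≤ 9n < (s + 1)².
      p≤s : p ≤ s
      p≤s = ≮⇒≥ λ s<p → <⇒≱ 9n<s² (begin
        suc s * suc s         ≤⟨ *-mono-≤ s<p s<p ⟩
        p * p                 ≤⟨ *-monoʳ-≤ p (m≤m*n p (p ^ k) {{>-nonZero (1≤^ k (prime⇒1≤ pp))}}) ⟩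
        p * (p * p ^ k)       ≡⟨ d≡p^ ⟨
        suc i                 ≤⟨ proj₂ bounds ⟩
        9 * n                 ∎)

  -- Without primes in the interval only proper prime powers contribute. Grouped by base, each of
  -- the s possible bases occurs at most once and contributes at most s.
  ∏-block≤ : ∀ x → ∏ (λ d → vm d ^ 𝟙 ((72 * n) ÷ d ≟ 8)) x ≤ s ^ s
  ∏-block≤ x = begin
    ∏ (λ d → vm d ^ 𝟙 ((72 * n) ÷ d ≟ 8)) x             ≤⟨ ∏-mono x (λ i _ → pointwise i) ⟩
    ∏ (λ d → ∏ (λ p → p ^ 𝟙 (powerIn? p d)) s) x        ≡⟨ ∏-swap (λ d p → p ^ 𝟙 (powerIn? p d)) x s ⟩
    ∏ (λ p → ∏ (λ d → p ^ 𝟙 (powerIn? p d)) x) s        ≤⟨ ∏-bound s (λ i i<s → ≤-trans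
                                                             (∏-unique≤ (powerIn? (suc i)) (suc i) x (s≤s z≤n) (unique i)) i<s) ⟩
    s ^ s                                               ∎
    where open ≤-Reasoning

-- Factorials ⌊x/j⌋! against x!

!-+-upper : ∀ r a → (r + a) ! ≤ a ! * (r + a) ^ r
!-+-upper zero    a = ≤-reflexive (sym (*-identityʳ (a !)))
!-+-upper (suc r) a = begin
  suc (r + a) * (r + a) !                      ≤⟨ *-monoʳ-≤ (suc (r + a)) (≤-trans (!-+-upper r a) (*-monoʳ-≤ (a !) (^-monoˡ-≤ r (n≤1+n (r + a))))) ⟩
  suc (r + a) * (a ! * suc (r + a) ^ r)        ≡⟨ shuffle (suc (r + a)) (a !) _ ⟩
  a ! * (suc (r + a) * suc (r + a) ^ r)        ∎
  where
  open ≤-Reasoning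
  shuffle : ∀ x y z → x * (y * z) ≡ y * (x * z)
  shuffle = solve-∀

!-+-lower : ∀ r a → a ! * a ^ r ≤ (r + a) !
!-+-lower zero    a = ≤-reflexive (*-identityʳ (a !))
!-+-lower (suc r) a = begin
  a ! * (a * a ^ r)            ≡⟨ shuffle (a !) a (a ^ r) ⟩
  a * (a ! * a ^ r)            ≤⟨ *-mono-≤ (m≤n⇒m≤1+n (m≤n+m a r)) (!-+-lower r a) ⟩
  suc (r + a) * (r + a) !      ∎
  where
  open ≤-Reasoning
  shuffle : ∀ x y z → x * (y * z) ≡ y * (x * z)
  shuffle = solve-∀

!-mono-≤ : ∀ {m n} → m ≤ n → m ! ≤ n !
!-mono-≤ {m} {n} m≤n with m≤n⇒m<n∨m≡n m≤n
... | inj₂ refl = ≤-refl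
!-mono-≤ {m} {suc n} _ | inj₁ m<n = ≤-trans (!-mono-≤ (≤-pred m<n)) (m≤n*m (n !) (suc n))

module Stirling (j : ℕ) where
  open ≤-Reasoning

  -- This is (j m)! after cutting it into m blocks of j consecutive factors and rounding each factor
  -- up to the multiple of j that closes its block.
  blockProduct : ℕ → ℕ
  blockProduct m = (m !) ^ j * j ^ (j * m)

  blockProduct-suc : ∀ m → blockProduct (suc m) ≡ blockProduct m * (j * suc m) ^ j
  blockProduct-suc m = begin-equality
    (suc m * m !) ^ j * j ^ (j * suc m)
      ≡⟨ cong₂ _*_ (^-distribʳ-* (suc m) (m !) j) (trans (cong (j ^_) (*-suc j m)) (^-distribˡ-+-* j j (j * m))) ⟩
    suc m ^ j * (m !) ^ j * (j ^ j * j ^ (j * m))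
      ≡⟨ shuffle (suc m ^ j) ((m !) ^ j) (j ^ j) (j ^ (j * m)) ⟩
    blockProduct m * (j ^ j * suc m ^ j)
      ≡⟨ cong (blockProduct m *_) (sym (^-distribʳ-* j (suc m) j)) ⟩
    blockProduct m * (j * suc m) ^ j ∎
    where
    shuffle : ∀ x y z w → x * y * (z * w) ≡ y * w * (z * x)
    shuffle = solve-∀

  !≤blockProduct : ∀ m → (j * m) ! ≤ blockProduct m
  !≤blockProduct zero = ≤-reflexive (trans (cong _! (*-zeroʳ j)) (sym (cong₂ _*_ (^-zeroˡ j) (cong (j ^_) (*-zeroʳ j)))))
  !≤blockProduct (suc m) = begin
    (j * suc m) !                       ≡⟨ cong _! (*-suc j m) ⟩
    (j + j * m) !                       ≤⟨ !-+-upper j (j * m) ⟩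
    (j * m) ! * (j + j * m) ^ j         ≤⟨ *-mono-≤ (!≤blockProduct m) (≤-reflexive (cong (_^ j) (sym (*-suc j m)))) ⟩
    blockProduct m * (j * suc m) ^ j    ≡⟨ blockProduct-suc m ⟨
    blockProduct (suc m)                ∎

  -- Shift by one block: the j factors following a multiple of j all exceed it.
  blockProduct≤! : ∀ m → blockProduct m ≤ (j * suc m) !
  blockProduct≤! zero = ≤-trans
    (≤-reflexive (cong₂ _*_ (^-zeroˡ j) (cong (j ^_) (*-zeroʳ j))))
    (1≤n! (j * 1))
  blockProduct≤! (suc m) = begin
    blockProduct (suc m)                    ≡⟨ blockProduct-suc m ⟩
    blockProduct m * (j * suc m) ^ j        ≤⟨ *-monoˡ-≤ ((j * suc m) ^ j) (blockProduct≤! m) ⟩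
    (j * suc m) ! * (j * suc m) ^ j         ≤⟨ !-+-lower j (j * suc m) ⟩
    (j + j * suc m) !                       ≡⟨ cong _! (*-suc j (suc m)) ⟨
    (j * suc (suc m)) !                     ∎

module _ {j x : ℕ} (1≤j : 1 ≤ j) (j≤x : j ≤ x) where
  open ≤-Reasoning
  open Stirling j
  private
    m = x ÷ j
    1≤x = ≤-trans 1≤j j≤x
    instance
      j≢0 : NonZero j
      j≢0 = >-nonZero 1≤j
      x≢0 : NonZero x
      x≢0 = >-nonZero 1≤x

    jm≤x : j * m ≤ x
    jm≤x = subst (_≤ x) (*-comm m j) (÷-lower x j)

    r = x ∸ j * m
    r+jm≡x : r + j * m ≡ x
    r+jm≡x = m∸n+n≡m jm≤x

    x<j[1+m] : ∀ j {{_ : NonZero j}} → x < suc (x ÷ j) * j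
    x<j[1+m] (suc j) = ÷-upper x j

    r≤j : r ≤ j
    r≤j = +-cancelʳ-≤ (j * m) r j (subst₂ _≤_ (sym r+jm≡x) (cong (j +_) (*-comm m j)) (<⇒≤ (x<j[1+m] j)))

    1≤m : ∀ j {{_ : NonZero j}} → j ≤ x → 1 ≤ x ÷ j
    1≤m (suc j) j≤x = ÷-greatest j (subst (_≤ x) (sym (*-identityˡ (suc j))) j≤x)

  -- This and `÷!^≤!` replace Stirling's formula. With x = r + j m, the r ≤ j leftover factors cost
  -- at most x ^ j, and the factorials themselves cancel later, leaving j ^ x as the main term.
  !≤÷!^ : x ! ≤ ((x ÷ j) !) ^ j * (j ^ x * x ^ j)
  !≤÷!^ = begin
    x !                                      ≡⟨ cong _! r+jm≡x ⟨
    (r + j * m) !                            ≤⟨ !-+-upper r (j * m) ⟩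
    (j * m) ! * (r + j * m) ^ r              ≤⟨ *-mono-≤ (!≤blockProduct m) (≤-trans (≤-reflexive (cong (_^ r) r+jm≡x)) (^-monoʳ-≤ x r≤j)) ⟩
    (m !) ^ j * j ^ (j * m) * x ^ j          ≤⟨ *-monoˡ-≤ (x ^ j) (*-monoʳ-≤ ((m !) ^ j) (^-monoʳ-≤ j jm≤x)) ⟩
    (m !) ^ j * j ^ x * x ^ j                ≡⟨ *-assoc ((m !) ^ j) (j ^ x) (x ^ j) ⟩
    (m !) ^ j * (j ^ x * x ^ j)              ∎

  ÷!^≤! : ((x ÷ j) !) ^ j * j ^ x ≤ x ! * x ^ (2 * j)
  ÷!^≤! = begin
    (m !) ^ j * j ^ x                        ≡⟨ cong (λ e → (m !) ^ j * j ^ e) r+jm≡x ⟨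
    (m !) ^ j * j ^ (r + j * m)              ≡⟨ cong ((m !) ^ j *_) (^-distribˡ-+-* j r (j * m)) ⟩
    (m !) ^ j * (j ^ r * j ^ (j * m))        ≡⟨ shuffle ((m !) ^ j) (j ^ r) (j ^ (j * m)) ⟩
    blockProduct m * j ^ r                   ≤⟨ *-mono-≤ (blockProduct≤ m (1≤m j j≤x) jm≤x) (≤-trans (^-monoˡ-≤ r j≤x) (^-monoʳ-≤ x r≤j)) ⟩
    x ! * x ^ j * x ^ j                      ≡⟨ *-assoc (x !) (x ^ j) (x ^ j) ⟩
    x ! * (x ^ j * x ^ j)                    ≡⟨ cong (x ! *_) (trans (sym (^-distribˡ-+-* x j j)) (cong (λ e → x ^ (j + e)) (sym (+-identityʳ j)))) ⟩
    x ! * x ^ (2 * j)                        ∎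
    where
    shuffle : ∀ a b c → a * (b * c) ≡ a * c * b
    shuffle = solve-∀
    -- Since `blockProduct≤!` overshoots by one block, the last block is split off and paid for with
    -- a factor x ^ j. The other x ^ j pays for j ^ r.
    blockProduct≤ : ∀ m → 1 ≤ m → j * m ≤ x → blockProduct m ≤ x ! * x ^ j
    blockProduct≤ (suc m) _ jm≤x = begin
      blockProduct (suc m)                   ≡⟨ blockProduct-suc m ⟩
      blockProduct m * (j * suc m) ^ j       ≤⟨ *-mono-≤ (≤-trans (blockProduct≤! m) (!-mono-≤ jm≤x)) (^-monoˡ-≤ j jm≤x) ⟩
      x ! * x ^ j                            ∎

-- Combined estimates for products of factorials

total : List (ℕ × ℕ) → ℕ
total []             = 0
total ((j , b) ∷ js) = b + total js

scale : List (ℕ × ℕ) → ℕ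
scale []             = 0
scale ((j , b) ∷ js) = j * b + scale js

-- The exponential of Σ b_j log j, that is, of the main term Σ (c_j / j) log j scaled by 45360.
geometric : List (ℕ × ℕ) → ℕ
geometric []             = 1
geometric ((j , b) ∷ js) = j ^ b * geometric js

Admissible : ℕ → List (ℕ × ℕ) → Set
Admissible x = All (λ (j , _) → 1 ≤ j × j ≤ x)

^-swap : ∀ m a b → (m ^ a) ^ b ≡ (m ^ b) ^ a
^-swap m a b = trans (^-*-assoc m a b) (trans (cong (m ^_) (*-comm a b)) (sym (^-*-assoc m b a)))

factorials-lower : ∀ {x} js → Admissible x js →
  (x !) ^ total js ≤ factorials x js * (geometric js ^ x * x ^ scale js)
factorials-lower {x} [] [] = ≤-reflexive (sym (trans (*-identityˡ _) (trans (*-identityʳ _) (^-zeroˡ x))))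
factorials-lower {x} ((j , b) ∷ js) ((1≤j , j≤x) ∷ adm) = begin
  (x !) ^ (b + total js)
    ≡⟨ ^-distribˡ-+-* (x !) b (total js) ⟩
  (x !) ^ b * (x !) ^ total js
    ≤⟨ *-mono-≤ (^-monoˡ-≤ b (!≤÷!^ 1≤j j≤x)) (factorials-lower js adm) ⟩
  (((x ÷ j) !) ^ j * (j ^ x * x ^ j)) ^ b * (F * (G ^ x * x ^ scale js))
    ≡⟨ cong (_* (F * (G ^ x * x ^ scale js))) (begin-equality
         (((x ÷ j) !) ^ j * (j ^ x * x ^ j)) ^ b
           ≡⟨ trans (^-distribʳ-* (((x ÷ j) !) ^ j) (j ^ x * x ^ j) b) (cong ((((x ÷ j) !) ^ j) ^ b *_) (^-distribʳ-* (j ^ x) (x ^ j) b)) ⟩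
         (((x ÷ j) !) ^ j) ^ b * ((j ^ x) ^ b * (x ^ j) ^ b)
           ≡⟨ cong₂ _*_ (^-*-assoc ((x ÷ j) !) j b) (cong₂ _*_ (^-swap j x b) (^-*-assoc x j b)) ⟩
         ((x ÷ j) !) ^ (j * b) * ((j ^ b) ^ x * x ^ (j * b)) ∎) ⟩
  ((x ÷ j) !) ^ (j * b) * ((j ^ b) ^ x * x ^ (j * b)) * (F * (G ^ x * x ^ scale js))
    ≡⟨ shuffle (((x ÷ j) !) ^ (j * b)) ((j ^ b) ^ x) (x ^ (j * b)) F (G ^ x) (x ^ scale js) ⟩
  ((x ÷ j) !) ^ (j * b) * F * ((j ^ b) ^ x * G ^ x * (x ^ (j * b) * x ^ scale js))
    ≡⟨ cong (((x ÷ j) !) ^ (j * b) * F *_) (cong₂ _*_ (sym (^-distribʳ-* (j ^ b) G x)) (sym (^-distribˡ-+-* x (j * b) (scale js)))) ⟩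
  ((x ÷ j) !) ^ (j * b) * F * ((j ^ b * G) ^ x * x ^ (j * b + scale js)) ∎
  where
  open ≤-Reasoning
  F = factorials x js
  G = geometric js
  shuffle : ∀ a b c d e f → a * (b * c) * (d * (e * f)) ≡ a * d * (b * e * (c * f))
  shuffle = solve-∀

factorials-upper : ∀ {x} js → Admissible x js →
  factorials x js * geometric js ^ x ≤ (x !) ^ total js * x ^ (2 * scale js)
factorials-upper {x} [] [] = ≤-reflexive (trans (*-identityˡ _) (^-zeroˡ x))
factorials-upper {x} ((j , b) ∷ js) ((1≤j , j≤x) ∷ adm) = begin
  ((x ÷ j) !) ^ (j * b) * F * (j ^ b * G) ^ x
    ≡⟨ cong (((x ÷ j) !) ^ (j * b) * F *_) (^-distribʳ-* (j ^ b) G x) ⟩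
  ((x ÷ j) !) ^ (j * b) * F * ((j ^ b) ^ x * G ^ x)
    ≡⟨ [m*n]*[o*p]≡[m*o]*[n*p] (((x ÷ j) !) ^ (j * b)) F ((j ^ b) ^ x) (G ^ x) ⟩
  ((x ÷ j) !) ^ (j * b) * (j ^ b) ^ x * (F * G ^ x)
    ≡⟨ cong (_* (F * G ^ x)) (begin-equality
         ((x ÷ j) !) ^ (j * b) * (j ^ b) ^ x       ≡⟨ cong₂ _*_ (sym (^-*-assoc ((x ÷ j) !) j b)) (^-swap j b x) ⟩
         (((x ÷ j) !) ^ j) ^ b * (j ^ x) ^ b       ≡⟨ ^-distribʳ-* (((x ÷ j) !) ^ j) (j ^ x) b ⟨
         (((x ÷ j) !) ^ j * j ^ x) ^ b             ∎) ⟩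
  (((x ÷ j) !) ^ j * j ^ x) ^ b * (F * G ^ x)
    ≤⟨ *-mono-≤ (^-monoˡ-≤ b (÷!^≤! 1≤j j≤x)) (factorials-upper js adm) ⟩
  (x ! * x ^ (2 * j)) ^ b * ((x !) ^ total js * x ^ (2 * scale js))
    ≡⟨ cong (_* ((x !) ^ total js * x ^ (2 * scale js)))
         (trans (^-distribʳ-* (x !) (x ^ (2 * j)) b) (cong ((x !) ^ b *_) (trans (^-*-assoc x (2 * j) b) (cong (x ^_) (*-assoc 2 j b))))) ⟩
  (x !) ^ b * x ^ (2 * (j * b)) * ((x !) ^ total js * x ^ (2 * scale js))
    ≡⟨ [m*n]*[o*p]≡[m*o]*[n*p] ((x !) ^ b) (x ^ (2 * (j * b))) ((x !) ^ total js) (x ^ (2 * scale js)) ⟩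
  (x !) ^ b * (x !) ^ total js * (x ^ (2 * (j * b)) * x ^ (2 * scale js))
    ≡⟨ cong₂ _*_ (sym (^-distribˡ-+-* (x !) b (total js)))
         (trans (sym (^-distribˡ-+-* x (2 * (j * b)) (2 * scale js))) (cong (x ^_) (sym (*-distribˡ-+ 2 (j * b) (scale js))))) ⟩
  (x !) ^ (b + total js) * x ^ (2 * (j * b + scale js)) ∎
  where
  open ≤-Reasoning
  F = factorials x js
  G = geometric js

factorials≥1 : ∀ x js → 1 ≤ factorials x js
factorials≥1 x []             = ≤-refl
factorials≥1 x ((j , b) ∷ js) = *-mono-≤ (1≤^ (j * b) (1≤n! (x ÷ j))) (factorials≥1 x js)

-- Growth of the error terms

stepRate : List (ℕ × ℕ) → ℕ
stepRate []             = 0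
stepRate ((t , u) ∷ us) = suc ((72 * u) ÷ suc t) + stepRate us

stepTotal≤ : ∀ us n → stepTotal us (72 * n) ≤ stepRate us * n
stepTotal≤ []             n = z≤n
stepTotal≤ ((t , u) ∷ us) n = begin
  (72 * n) ÷ suc t * u + stepTotal us (72 * n)   ≤⟨ +-mono-≤ one (stepTotal≤ us n) ⟩
  rate * n + stepRate us * n                     ≡⟨ *-distribʳ-+ n rate (stepRate us) ⟨
  (rate + stepRate us) * n                       ∎
  where
  open ≤-Reasoning
  rate = suc ((72 * u) ÷ suc t)
  swap₁ : ∀ a b c → a * b * c ≡ a * c * b
  swap₁ = solve-∀
  one : (72 * n) ÷ suc t * u ≤ rate * n
  one = *-cancelʳ-≤ _ _ (suc t) (begin
    (72 * n) ÷ suc t * u * suc t        ≡⟨ swap₁ ((72 * n) ÷ suc t) u (suc t) ⟩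
    (72 * n) ÷ suc t * suc t * u        ≤⟨ *-monoˡ-≤ u (÷-lower (72 * n) (suc t)) ⟩
    72 * n * u                          ≡⟨ swap₁ 72 n u ⟩
    72 * u * n                          ≤⟨ *-monoˡ-≤ n (<⇒≤ (÷-upper (72 * u) t)) ⟩
    rate * suc t * n                    ≡⟨ swap₁ rate (suc t) n ⟩
    rate * n * suc t                    ∎)

-- With q = s / 1024 ≥ 1 one has s + 1 ≤ 2 ^ (10 + q) and 72 n ≤ 2 ^ (23 + 2 q), so that the right-hand
-- side is at most 2 ^ O(q s), while γ n is of order q s too, with a larger constant.
growth : ∀ {D E γ} n s → E ≤ 34 * D → 107 * D < γ * 1024 → 1024 ≤ s → s * s ≤ 9 * n → 9 * n < suc s * suc s →
         ¬ 2 ^ (γ * n) ≤ (s ^ s) ^ D * (72 * n) ^ E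
growth {D} {E} {γ} n s E≤ D<γ 1024≤s s²≤9n 9n<s² bound = <⇒≱ contra upper
  where
  open ≤-Reasoning
  q = s ÷ 1024
  1≤q : 1 ≤ q
  1≤q = ÷-greatest 1023 1024≤s
  1024q≤s : 1024 * q ≤ s
  1024q≤s = subst (_≤ s) (*-comm q 1024) (÷-lower s 1024)

  s<2^ : suc s ≤ 2 ^ (10 + q)
  s<2^ = begin
    suc s              ≤⟨ ÷-upper s 1023 ⟩
    suc q * 1024       ≡⟨ *-comm (suc q) 1024 ⟩
    2 ^ 10 * suc q     ≤⟨ *-monoʳ-≤ (2 ^ 10) (n<m^n q (s≤s (s≤s z≤n))) ⟩
    2 ^ 10 * 2 ^ q     ≡⟨ ^-distribˡ-+-* 2 10 q ⟨
    2 ^ (10 + q)       ∎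

  72n≤2^ : 72 * n ≤ 2 ^ (3 + 2 * (10 + q))
  72n≤2^ = begin
    72 * n                             ≡⟨ *-assoc 8 9 n ⟩
    8 * (9 * n)                        ≤⟨ *-monoʳ-≤ 8 (≤-trans (<⇒≤ 9n<s²) (*-mono-≤ s<2^ s<2^)) ⟩
    8 * (2 ^ (10 + q) * 2 ^ (10 + q))  ≡⟨ cong (8 *_) (trans (sym (^-distribˡ-+-* 2 (10 + q) (10 + q))) (cong (λ e → 2 ^ (10 + q + e)) (sym (+-identityʳ (10 + q))))) ⟩
    2 ^ 3 * 2 ^ (2 * (10 + q))         ≡⟨ ^-distribˡ-+-* 2 3 (2 * (10 + q)) ⟨
    2 ^ (3 + 2 * (10 + q))             ∎

  exponent = (10 + q) * (s * D) + (3 + 2 * (10 + q)) * E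

  γn≤ : γ * n ≤ exponent
  γn≤ = ≮⇒≥ λ lt → <⇒≱ (^-monoʳ-< 2 (s≤s (s≤s z≤n)) lt) (begin
    2 ^ (γ * n)                                                      ≤⟨ bound ⟩
    (s ^ s) ^ D * (72 * n) ^ E                                       ≡⟨ cong (_* (72 * n) ^ E) (^-*-assoc s s D) ⟩
    s ^ (s * D) * (72 * n) ^ E                                       ≤⟨ *-mono-≤ (^-monoˡ-≤ (s * D) (<⇒≤ s<2^)) (^-monoˡ-≤ E 72n≤2^) ⟩
    (2 ^ (10 + q)) ^ (s * D) * (2 ^ (3 + 2 * (10 + q))) ^ E          ≡⟨ cong₂ _*_ (^-*-assoc 2 (10 + q) (s * D)) (^-*-assoc 2 (3 + 2 * (10 + q)) E) ⟩
    2 ^ ((10 + q) * (s * D)) * 2 ^ ((3 + 2 * (10 + q)) * E)          ≡⟨ ^-distribˡ-+-* 2 ((10 + q) * (s * D)) ((3 + 2 * (10 + q)) * E) ⟨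
    2 ^ exponent                                                     ∎)

  10+q≤ : 10 + q ≤ 11 * q
  10+q≤ = subst (10 + q ≤_) (+-comm (10 * q) q) (+-monoˡ-≤ q (*-monoʳ-≤ 10 1≤q))

  23+2q≤ : 3 + 2 * (10 + q) ≤ 25 * q
  23+2q≤ = begin
    3 + 2 * (10 + q)       ≡⟨ cong (3 +_) (*-distribˡ-+ 2 10 q) ⟩
    23 * 1 + 2 * q         ≤⟨ +-monoˡ-≤ (2 * q) (*-monoʳ-≤ 23 1≤q) ⟩
    23 * q + 2 * q         ≡⟨ *-distribʳ-+ q 23 2 ⟨
    25 * q                 ∎

  upper : 9 * exponent ≤ 107 * D * (q * s)
  upper = begin
    9 * exponent                                          ≤⟨ *-monoʳ-≤ 9 (+-mono-≤ (*-monoˡ-≤ (s * D) 10+q≤) (*-mono-≤ 23+2q≤ E≤)) ⟩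
    9 * (11 * q * (s * D) + 25 * q * (34 * D))            ≡⟨ expand q s D ⟩
    -- The constant 107 is 99 + 8: the part from s ^ s gives 9 · 11 = 99, and 9 · 25 · 34 = 7650 is
    -- below 8 · 1024 ≤ 8 s.
    99 * (D * (q * s)) + 7650 * (D * q)                   ≤⟨ +-monoʳ-≤ (99 * (D * (q * s))) (begin
        7650 * (D * q)                                      ≤⟨ *-monoˡ-≤ (D * q) (≤-trans (m≤m+n 7650 542) (*-monoʳ-≤ 8 1024≤s)) ⟩
        8 * s * (D * q)                                     ≡⟨ regroup s D q ⟩
        8 * (D * (q * s))                                   ∎) ⟩
    99 * (D * (q * s)) + 8 * (D * (q * s))                ≡⟨ *-distribʳ-+ (D * (q * s)) 99 8 ⟨
    107 * (D * (q * s))                                   ≡⟨ *-assoc 107 D (q * s) ⟨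
    107 * D * (q * s)                                     ∎
    where
    expand : ∀ q s D → 9 * (11 * q * (s * D) + 25 * q * (34 * D)) ≡ 99 * (D * (q * s)) + 7650 * (D * q)
    expand = solve-∀
    regroup : ∀ s D q → 8 * s * (D * q) ≡ 8 * (D * (q * s))
    regroup = solve-∀

  contra : 107 * D * (q * s) < 9 * exponent
  contra = begin-strict
    107 * D * (q * s)             <⟨ *-monoˡ-< (q * s) {{>-nonZero (*-mono-≤ 1≤q (≤-trans (s≤s z≤n) 1024≤s))}} D<γ ⟩
    γ * 1024 * (q * s)            ≡⟨ regroup₁ γ 1024 q s ⟩
    γ * (1024 * q * s)            ≤⟨ *-monoʳ-≤ γ (≤-trans (*-monoˡ-≤ s 1024q≤s) s²≤9n) ⟩
    γ * (9 * n)                   ≡⟨ regroup₂ γ n ⟩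
    9 * (γ * n)                   ≤⟨ *-monoʳ-≤ 9 γn≤ ⟩
    9 * exponent                  ∎
    where
    regroup₁ : ∀ g c q s → g * c * (q * s) ≡ g * (c * q * s)
    regroup₁ = solve-∀
    regroup₂ : ∀ g n → g * (9 * n) ≡ 9 * (g * n)
    regroup₂ = solve-∀

⌊√_⌋ : ∀ m → ∃[ s ] (s * s ≤ m × m < suc s * suc s)
⌊√ zero ⌋ = 0 , z≤n , s≤s z≤n
⌊√ suc m ⌋ with ⌊√ m ⌋
... | s , lo , hi with suc s * suc s ≤? suc m
...   | no ≰  = s , m≤n⇒m≤1+n lo , ≰⇒> ≰
...   | yes ≤ = suc s , ≤ , ≤-<-trans hi (*-mono-< (n<1+n (suc s)) (n<1+n (suc s)))

≡true⇒T : ∀ {b} → b ≡ true → T b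
≡true⇒T eq = subst T (sym eq) tt

T-∧⁻ : ∀ {a b} → T (a ∧ b) → T a × T b
T-∧⁻ = Equivalence.to T-∧

-- Bounding the weights

allBelow : (ℕ → Bool) → ℕ → Bool
allBelow f zero    = true
allBelow f (suc n) = f n ∧ allBelow f n

allBelow⇒ : ∀ f n {z} → T (allBelow f n) → z < n → T (f z)
allBelow⇒ f (suc n) {z} t z<n with T-∧⁻ {f n} t | m<1+n⇒m<n∨m≡n z<n
... | fn , _    | inj₂ refl = fn
... | _  , rest | inj₁ z<n′ = allBelow⇒ f n rest z<n′

-- The most that rounding can cost, as j ⌊z/j⌋ ≥ z - (j - 1).
slack : List (ℕ × ℕ) → ℕ
slack []             = 0
slack ((j , b) ∷ js) = b * (j ∸ 1) + slack js

weight-upper : ∀ js z → weight js z ≤ total js * z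
weight-upper []             z = z≤n
weight-upper ((j , b) ∷ js) z = begin
  j * b * (z ÷ j) + weight js z      ≤⟨ +-mono-≤ one (weight-upper js z) ⟩
  b * z + total js * z               ≡⟨ *-distribʳ-+ z b (total js) ⟨
  (b + total js) * z                 ∎
  where
  open ≤-Reasoning
  regroup : ∀ j b y → j * b * y ≡ b * (y * j)
  regroup = solve-∀
  one : j * b * (z ÷ j) ≤ b * z
  one = ≤-trans (≤-reflexive (regroup j b (z ÷ j))) (*-monoʳ-≤ b (÷-lower z j))

weight-lower : ∀ js z → All (λ (j , _) → 1 ≤ j) js → total js * z ≤ weight js z + slack js
weight-lower []             z [] = z≤n
weight-lower ((suc j , b) ∷ js) z (_ ∷ 1≤js) = begin
  (b + total js) * z                                              ≡⟨ *-distribʳ-+ z b (total js) ⟩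
  b * z + total js * z                                            ≤⟨ +-mono-≤ (*-monoʳ-≤ b (≤-pred (÷-upper z j))) (weight-lower js z 1≤js) ⟩
  b * (j + z ÷ suc j * suc j) + (weight js z + slack js)          ≡⟨ regroup b j (z ÷ suc j) (weight js z) (slack js) ⟩
  suc j * b * (z ÷ suc j) + weight js z + (b * j + slack js)      ∎
  where
  open ≤-Reasoning
  regroup : ∀ b j y w s → b * (j + y * suc j) + (w + s) ≡ suc j * b * y + w + (b * j + s)
  regroup = solve-∀

step-mono : ∀ us {y z} → y ≤ z → step us y ≤ step us z
step-mono []             y≤z = z≤n
step-mono ((t , u) ∷ us) {y} {z} y≤z = +-mono-≤ (*-monoʳ-≤ u one) (step-mono us y≤z)
  where
  one : 𝟙 (t <? y) ≤ 𝟙 (t <? z)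
  one with t <? y
  ... | yes t<y = subst₂ _≤_ (sym (𝟙-yes (t <? y) t<y)) (sym (𝟙-yes (t <? z) (<-≤-trans t<y y≤z))) ≤-refl
  ... | no t≮y  = subst (_≤ 𝟙 (t <? z)) (sym (𝟙-no (t <? y) t≮y)) z≤n

weightBound : (P N U : List (ℕ × ℕ)) (D z : ℕ) → Bool
weightBound P N U D z = weight P z ≤ᵇ weight N z + (D * 𝟙 (z ≟ 8) + step U z)

-- Below B this is a finite computation. From B on the linear parts cancel because the totals agree,
-- and the rounding loss is covered by the jumps of U up to B.
weight-≤ : ∀ P N U D B → total P ≡ total N → All (λ (j , _) → 1 ≤ j) N → slack N ≤ step U B →
           allBelow (weightBound P N U D) B ≡ true → ∀ z → weight P z ≤ weight N z + (D * 𝟙 (z ≟ 8) + step U z)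
weight-≤ P N U D B total-≡ 1≤N slack-≤ below z with z <? B
... | yes z<B = ≤ᵇ⇒≤ (weight P z) _ (allBelow⇒ (weightBound P N U D) B (≡true⇒T below) z<B)
... | no  z≮B = begin
  weight P z                                        ≤⟨ weight-upper P z ⟩
  total P * z                                       ≡⟨ cong (_* z) total-≡ ⟩
  total N * z                                       ≤⟨ weight-lower N z 1≤N ⟩
  weight N z + slack N                              ≤⟨ +-monoʳ-≤ (weight N z) (≤-trans slack-≤ (step-mono U (≮⇒≥ z≮B))) ⟩
  weight N z + step U z                             ≤⟨ +-monoʳ-≤ (weight N z) (m≤n+m (step U z) (D * 𝟙 (z ≟ 8))) ⟩
  weight N z + (D * 𝟙 (z ≟ 8) + step U z)           ∎
  where open ≤-Reasoning

admissible-mono : ∀ {x y js} → x ≤ y → Admissible x js → Admissible y js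
admissible-mono x≤y = All.map λ (1≤j , j≤x) → 1≤j , ≤-trans j≤x x≤y

-- The main inequality

module Certificate
  (P N U : List (ℕ × ℕ)) (D κ γ B c : ℕ)
  (total-≡ : total P ≡ total N)
  (geometric-≤ : geometric P * 2 ^ κ ≤ geometric N)
  (rate-≤ : 2 * stepRate U + γ ≤ κ * 72)
  (weight-below : allBelow (weightBound P N U D) B ≡ true)
  (slack-≤ : slack N ≤ step U B)
  (admissible-P : Admissible c P)
  (admissible-N : Admissible c N)
  (scale-≤ : scale P + 2 * scale N ≤ 34 * D)
  (D<γ : 107 * D < γ * 1024)
  where

  E : ℕ
  E = scale P + 2 * scale N

  -- The main term supplies at least κ bits per unit of x = 72n, the majorant U consumes at most 2
  -- `stepRate U` bits per unit of n, and γ bits remain. They must be paid for by the prime powers,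
  -- through s ^ s, and by the polynomial errors x ^ E.
  noPrime⇒2^≤ : ∀ n s → c ≤ 72 * n → 9 * n < suc s * suc s →
                (∀ p → Prime p → 8 * n < p → ¬ p < 9 * n) →
                2 ^ (γ * n) ≤ (s ^ s) ^ D * (72 * n) ^ E
  noPrime⇒2^≤ n s c≤ 9n<s² noPrime = *-cancelʳ-≤ _ _ tail {{>-nonZero 1≤tail}} (begin
    2 ^ (γ * n) * tail                          ≡⟨ cong (2 ^ (γ * n) *_) (^-*-assoc 2 2 (stepRate U * n)) ⟩
    2 ^ (γ * n) * 2 ^ (2 * (stepRate U * n))    ≡⟨ ^-distribˡ-+-* 2 (γ * n) (2 * (stepRate U * n)) ⟨
    2 ^ (γ * n + 2 * (stepRate U * n))          ≤⟨ ^-monoʳ-≤ 2 exponent ⟩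
    2 ^ (κ * x)                                 ≡⟨ ^-*-assoc 2 κ x ⟨
    (2 ^ κ) ^ x                                 ≤⟨ gain ⟩
    (s ^ s) ^ D * tail * x ^ E                  ≡⟨ shuffle₁ ((s ^ s) ^ D) tail (x ^ E) ⟩
    (s ^ s) ^ D * x ^ E * tail                  ∎)
    where
    open ≤-Reasoning
    x = 72 * n
    tail = 4 ^ (stepRate U * n)
    1≤tail = m^n>0 4 (stepRate U * n)
    FP = factorials x P
    FN = factorials x N
    GP = geometric P
    GN = geometric N
    R = (s ^ s) ^ D * tail
    admP = admissible-mono c≤ admissible-P
    admN = admissible-mono c≤ admissible-N

    shuffle₁ : ∀ a b c → a * b * c ≡ a * c * b
    shuffle₁ = solve-∀

    exponent : γ * n + 2 * (stepRate U * n) ≤ κ * x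
    exponent = begin
      γ * n + 2 * (stepRate U * n)       ≡⟨ collect γ n (stepRate U) ⟩
      (2 * stepRate U + γ) * n           ≤⟨ *-monoˡ-≤ n rate-≤ ⟩
      κ * 72 * n                         ≡⟨ *-assoc κ 72 n ⟩
      κ * (72 * n)                       ∎
      where
      collect : ∀ g n v → g * n + 2 * (v * n) ≡ (2 * v + g) * n
      collect = solve-∀

    FP≤ : FP ≤ FN * R
    FP≤ = begin
      FP
        ≡⟨ factorials-as-∏ x P ⟩
      ∏ (λ d → vm d ^ weight P (x ÷ d)) x
        ≤⟨ ∏-vm-mono (λ d → weight P (x ÷ d)) (λ d → weight N (x ÷ d) + (D * 𝟙 (x ÷ d ≟ 8) + step U (x ÷ d))) x
             (λ i _ → weight-≤ P N U D B total-≡ (All.map proj₁ admissible-N) slack-≤ weight-below (x ÷ suc i)) ⟩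
      ∏ (λ d → vm d ^ (weight N (x ÷ d) + (D * 𝟙 (x ÷ d ≟ 8) + step U (x ÷ d)))) x
        ≡⟨ ∏-^-+ vm (λ d → weight N (x ÷ d)) (λ d → D * 𝟙 (x ÷ d ≟ 8) + step U (x ÷ d)) x ⟩
      ∏ (λ d → vm d ^ weight N (x ÷ d)) x * ∏ (λ d → vm d ^ (D * 𝟙 (x ÷ d ≟ 8) + step U (x ÷ d))) x
        ≡⟨ cong₂ _*_ (sym (factorials-as-∏ x N)) (∏-^-+ vm (λ d → D * 𝟙 (x ÷ d ≟ 8)) (λ d → step U (x ÷ d)) x) ⟩
      FN * (∏ (λ d → vm d ^ (D * 𝟙 (x ÷ d ≟ 8))) x * ∏ (λ d → vm d ^ step U (x ÷ d)) x)
        ≤⟨ *-monoʳ-≤ FN (*-mono-≤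
             (≤-trans (≤-reflexive (∏-vm-^ (λ d → 𝟙 (x ÷ d ≟ 8)) D x)) (^-monoˡ-≤ D (PrimePowers.∏-block≤ n s 9n<s² noPrime x)))
             (≤-trans (∏-vm-step x U) (^-monoʳ-≤ 4 (stepTotal≤ U n)))) ⟩
      FN * R ∎

    gain : (2 ^ κ) ^ x ≤ R * x ^ E
    -- Equal totals make the powers of x! match, so x! is eliminated between the upper estimate for
    -- N and the lower one for P.
    gain = *-cancelˡ-≤ (FN * GP ^ x) {{>-nonZero (*-mono-≤ (factorials≥1 x N) (1≤^ x (geometric≥1 P admP)))}} (begin
      FN * GP ^ x * (2 ^ κ) ^ x                                 ≡⟨ *-assoc FN (GP ^ x) _ ⟩
      FN * (GP ^ x * (2 ^ κ) ^ x)                               ≡⟨ cong (FN *_) (^-distribʳ-* GP (2 ^ κ) x) ⟨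
      FN * (GP * 2 ^ κ) ^ x                                     ≤⟨ *-monoʳ-≤ FN (^-monoˡ-≤ x geometric-≤) ⟩
      FN * GN ^ x                                               ≤⟨ factorials-upper N admN ⟩
      (x !) ^ total N * x ^ (2 * scale N)                       ≡⟨ cong (λ t → (x !) ^ t * x ^ (2 * scale N)) total-≡ ⟨
      (x !) ^ total P * x ^ (2 * scale N)                       ≤⟨ *-monoˡ-≤ (x ^ (2 * scale N)) (factorials-lower P admP) ⟩
      FP * (GP ^ x * x ^ scale P) * x ^ (2 * scale N)           ≤⟨ *-monoˡ-≤ (x ^ (2 * scale N)) (*-monoˡ-≤ (GP ^ x * x ^ scale P) FP≤) ⟩
      FN * R * (GP ^ x * x ^ scale P) * x ^ (2 * scale N)       ≡⟨ shuffle₂ FN R (GP ^ x) (x ^ scale P) (x ^ (2 * scale N)) ⟩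
      FN * GP ^ x * (R * (x ^ scale P * x ^ (2 * scale N)))     ≡⟨ cong (λ e → FN * GP ^ x * (R * e)) (^-distribˡ-+-* x (scale P) (2 * scale N)) ⟨
      FN * GP ^ x * (R * x ^ E)                                 ∎)
      where
      shuffle₂ : ∀ a b c d e → a * b * (c * d) * e ≡ a * c * (b * (d * e))
      shuffle₂ = solve-∀
      geometric≥1 : ∀ js → Admissible x js → 1 ≤ geometric js
      geometric≥1 []             []                = ≤-refl
      geometric≥1 ((j , b) ∷ js) ((1≤j , _) ∷ adm) = *-mono-≤ (1≤^ b 1≤j) (geometric≥1 js adm)

  ¬primeless : ∀ n → c ≤ 72 * n → 1024 * 1024 ≤ 9 * n →
                ¬ (∀ p → Prime p → 8 * n < p → ¬ p < 9 * n)
  ¬primeless n c≤ large noPrime with ⌊√ 9 * n ⌋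
  ... | s , lo , hi = growth {D} {E} {γ} n s scale-≤ D<γ (≮⇒≥ λ s< → <⇒≱ hi (≤-trans (*-mono-≤ s< s<) large)) lo hi
                        (noPrime⇒2^≤ n s c≤ hi noPrime)

-- Small n

-- The last argument is fuel, and exhausting it counts as failure. The amount 1024 used below
-- suffices for p < 2 ^ 20.
trial : ℕ → ℕ → ℕ → Bool
trial p d zero    = false
trial p d (suc k) = if p <ᵇ d * d then true else (not (does (d ∣? p)) ∧ trial p (suc d) k)

trial⇒Prime : ∀ {p} d k → .{{NonTrivial p}} → d Rough p → T (trial p d k) → Prime p
trial⇒Prime {p} d (suc k) rough t with p <ᵇ d * d in eq
... | true  = rough∧square>⇒prime rough (<ᵇ⇒< p (d * d) (subst T (sym eq) tt))
... | false with d ∣? p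
...   | no d∤p = trial⇒Prime (suc d) k (∤⇒rough-suc d∤p rough) t

-- Here a is the least n not yet covered. As p < 9a, the prime p serves every n ≥ a with 8n < p, and
-- the first n beyond those is p / 8 rounded up.
chain : ℕ → List ℕ → Bool
chain a []       = true
chain a (p ∷ ps) = (1 <ᵇ p) ∧ (trial p 2 1024 ∧ ((p <ᵇ 9 * a) ∧ chain ((p + 7) ÷ 8) ps))

chainEnd : ℕ → List ℕ → ℕ
chainEnd a []       = a
chainEnd a (p ∷ ps) = chainEnd ((p + 7) ÷ 8) ps

chain⇒prime : ∀ a ps n → T (chain a ps) → a ≤ n → n < chainEnd a ps → ∃[ p ] (Prime p × 8 * n < p × p < 9 * n)
chain⇒prime a [] n _ a≤n n<a = contradiction a≤n (<⇒≱ n<a)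
chain⇒prime a (p ∷ ps) n t a≤n n<end with T-∧⁻ {1 <ᵇ p} t
... | 1<p , t₁ with T-∧⁻ {trial p 2 1024} t₁
... | tr , t₂ with T-∧⁻ {p <ᵇ 9 * a} t₂ | 8 * n <? p
... | p<9a , _  | yes 8n<p =
  p , trial⇒Prime 2 1024 {{n>1⇒nonTrivial (<ᵇ⇒< 1 p 1<p)}} 2-rough tr , 8n<p , <-≤-trans (<ᵇ⇒< p (9 * a) p<9a) (*-monoʳ-≤ 9 a≤n)
... | _    , t₃ | no 8n≮p = chain⇒prime ((p + 7) ÷ 8) ps n t₃ (≤-pred (*-cancelʳ-< 8 ((p + 7) ÷ 8) (suc n) (begin-strict
    (p + 7) ÷ 8 * 8      ≤⟨ ÷-lower (p + 7) 8 ⟩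
    p + 7                ≤⟨ +-monoˡ-≤ 7 (≮⇒≥ 8n≮p) ⟩
    8 * n + 7            <⟨ +-monoʳ-< (8 * n) (n<1+n 7) ⟩
    8 * n + 8            ≡⟨ +-comm (8 * n) 8 ⟩
    8 + 8 * n            ≡⟨ *-suc 8 n ⟨
    8 * suc n            ≡⟨ *-comm 8 (suc n) ⟩
    suc n * 8            ∎))) n<end
  where open ≤-Reasoning

-- b_j for c_j > 0 in P, |b_j| for c_j < 0 in N, and the majorant of W in U, from a linear program that
-- maximises the resulting lower bound for the product over 8 n < d ≤ 9 n.
P N U : List (ℕ × ℕ)
P = (8 , 5670) ∷ (18 , 2520) ∷ (27 , 1680) ∷ (45 , 1008) ∷ (48 , 945) ∷ (63 , 720) ∷ (80 , 567) ∷ (112 , 405) ∷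
    (153 , 296) ∷ (162 , 228) ∷ (168 , 197) ∷ (180 , 252) ∷ []
N = (9 , 5040) ∷ (16 , 2835) ∷ (24 , 1890) ∷ (40 , 1134) ∷ (54 , 840) ∷ (56 , 810) ∷ (81 , 560) ∷ (90 , 504) ∷
    (126 , 360) ∷ (144 , 144) ∷ (152 , 162) ∷ (171 , 144) ∷ (189 , 65) ∷ []
U = (188 , 33051) ∷ (583 , 6) ∷ (1351 , 20724) ∷ (1495 , 12240) ∷ (3063 , 12900) ∷ (4743 , 16770) ∷ (8647 , 492) ∷
    (19999 , 379838) ∷ []

-- Numerical verification and conclusion

abstract
  weight-below : allBelow (weightBound P N U 45360) 20000 ≡ true
  weight-below = refl

  total-PN : total P ≡ total N
  total-PN = refl

  geometric-PN : geometric P * 2 ^ 524 ≤ geometric N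
  geometric-PN = ≤ᵇ⇒≤ (geometric P * 2 ^ 524) (geometric N) tt

  -- Equality holds: `stepRate U` is 16218, and 5292 = 524 · 72 - 2 · 16218.
  rate-U : 2 * stepRate U + 5292 ≤ 524 * 72
  rate-U = ≤ᵇ⇒≤ (2 * stepRate U + 5292) (524 * 72) tt

  -- Both sides are 476021. The last jump of U, at 20000, is sized to bring the sum of all jumps up
  -- to the rounding loss.
  slack-N : slack N ≤ step U 20000
  slack-N = ≤ᵇ⇒≤ (slack N) (step U 20000) tt

  scale-PN : scale P + 2 * scale N ≤ 34 * 45360
  scale-PN = ≤ᵇ⇒≤ (scale P + 2 * scale N) (34 * 45360) tt

  D<γ : 107 * 45360 < 5292 * 1024
  D<γ = <ᵇ⇒< (107 * 45360) (5292 * 1024) tt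

  admissible-P : Admissible 189 P
  admissible-P = toWitness {a? = All.all? (λ (j , _) → (1 ≤? j) ×-dec (j ≤? 189)) P} tt

  admissible-N : Admissible 189 N
  admissible-N = toWitness {a? = All.all? (λ (j , _) → (1 ≤? j) ×-dec (j ≤? 189)) N} tt

-- The threshold is where the chain of primes ends, 1004687 / 8 rounded up. It makes 9n at least
-- 1024², as the growth estimate requires.
¬primeless : ∀ n → 125586 ≤ n → ¬ (∀ p → Prime p → 8 * n < p → ¬ p < 9 * n)
¬primeless n n≥ = Certificate.¬primeless P N U 45360 524 5292 20000 189
  total-PN geometric-PN rate-U weight-below slack-N admissible-P admissible-N scale-PN D<γ n
  (≤-trans (≤ᵇ⇒≤ 189 (72 * 125586) tt) (*-monoʳ-≤ 72 n≥))
  (≤-trans (≤ᵇ⇒≤ (1024 * 1024) (9 * 125586) tt) (*-monoʳ-≤ 9 n≥))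

primes : List ℕ
primes = 43 ∷ 53 ∷ 61 ∷ 71 ∷ 79 ∷ 89 ∷ 107 ∷ 113 ∷ 131 ∷ 151 ∷ 167 ∷ 181 ∷ 199 ∷ 223 ∷ 251 ∷ 283 ∷ 317 ∷ 359 ∷ 401 ∷
  457 ∷ 521 ∷ 593 ∷ 673 ∷ 761 ∷ 863 ∷ 971 ∷ 1097 ∷ 1237 ∷ 1381 ∷ 1553 ∷ 1753 ∷ 1979 ∷ 2221 ∷ 2477 ∷ 2789 ∷ 3137 ∷
  3533 ∷ 3967 ∷ 4463 ∷ 5021 ∷ 5651 ∷ 6361 ∷ 7159 ∷ 8053 ∷ 9059 ∷ 10193 ∷ 11471 ∷ 12899 ∷ 14503 ∷ 16301 ∷ 18341 ∷
  20627 ∷ 23209 ∷ 26113 ∷ 29383 ∷ 33053 ∷ 37181 ∷ 41813 ∷ 47041 ∷ 52919 ∷ 59513 ∷ 66959 ∷ 75329 ∷ 84751 ∷ 95339 ∷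
  107251 ∷ 120661 ∷ 135743 ∷ 152681 ∷ 171763 ∷ 193201 ∷ 217351 ∷ 244507 ∷ 275059 ∷ 309437 ∷ 348097 ∷ 391613 ∷
  440567 ∷ 495637 ∷ 557591 ∷ 627271 ∷ 705643 ∷ 793853 ∷ 893059 ∷ 1004687 ∷ []

abstract
  chain-primes : chain 5 primes ≡ true
  chain-primes = refl

  chainEnd-primes : chainEnd 5 primes ≡ 125586
  chainEnd-primes = refl

theorem2p2p10 : ∀ (n : ℕ) → n > 4 → ∃[ p ] (Prime p × 8 * n < p × p < 9 * n)
theorem2p2p10 n n>4 with n <? 125586
... | yes n< = chain⇒prime 5 primes n (≡true⇒T chain-primes) n>4 (subst (n <_) (sym chainEnd-primes) n<)
-- A bounded decidable search turns the refutation of primelessness into an actual witness.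
... | no  n≮ with anyUpTo? (λ p → prime? p ×-dec (8 * n <? p)) (9 * n)
...   | yes (p , p<9n , pp , 8n<p) = p , pp , 8n<p , p<9n
...   | no  none = contradiction (λ p pp 8n<p p<9n → none (p , p<9n , pp , 8n<p)) (¬primeless n (≮⇒≥ n≮))
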